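{- Let $(v,b)$ satisfy (C1) or (C2). Then every NWBTS$(v;b)$ $(V,\mathcal F)$ is an optimal data placement, i.e. $P(\mathcal F,x)\le P(\mathcal F',x)$ for every TS$(v;b)$ $(V,\mathcal F')$ and every real $x\ge 1$.
   Context: A triple system TS$(v;b)$ is a pair $(V,\mathcal F)$ where $V$ is a set of $v\ge3$ points and $\mathcal F=(B_1,\dots,B_b)$ is a multiset of $b$ 3-subsets of $V$ (blocks); repeated blocks are allowed. $P(\mathcal F,x)=\sum_{j=0}^3 v_jx^j$, where $v_j$ is the number of ordered pairs $(i,i')$, $i\ne i'$, with $|B_i\cap B_{i'}|=j$. For distinct $x_1,\dots,x_j\in V$, $\lambda_{x_1,\dots,x_j}$ is the number of blocks (with multiplicity) containing $\{x_1,\dots,x_j\}$. $(V,\mathcal F)$ is $j$-balanced if $|\lambda_{x_1,\dots,x_j}-\lambda_{y_1,\dots,y_j}|\le 1$ for any two $j$-subsets. The associated pair $(\lambda,\varepsilon)$ of $(v,b)$: integers with $3b=\lambda\binom v2+\varepsilon$, $-v/2<\varepsilon<v/2$. (C1): $v\equiv 2\pmod 3$ and $b\in\{\lfloor \lambda v(v-1)/6\rfloor,\lceil \lambda v(v-1)/6\rceil\}$ for an integer $\lambda$ with $\lambda\equiv1,2\pmod 3$ if $v\equiv5\pmod6$ and $\lambda\equiv 2,4\pmod 6$ if $v\equiv2\pmod 6$. (C2): $v$ even and $\lambda v(v-1)/6-v/6<b<\lambda v(v-1)/6+v/6$ for an odd integer $\lambda$. In both cases $\lambda$ is the $\lambda$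 of the associated pair. Defect graph: if all $\lambda_{x,y}\in\{\lambda-1,\lambda,\lambda+1\}$, the defect graph is the graph on $V$ with edges $D_1=\{\{x,y\}:\lambda_{x,y}=\lambda+1\}$ (labelled $+1$) and $D_{ -1}=\{\{x,y\}:\lambda_{x,y}=\lambda-1\}$ (labelled $-1$); isomorphisms preserve labels. $G_1$: triangle, two $+1$ edges, one $-1$ edge; $G_{ -1}$: triangle, one $+1$, two $-1$; $G_2$: 4-cycle, three $+1$, one $-1$; $G_{ -2}$: 4-cycle, one $+1$, three $-1$. For even $v$: $H^0_{v,\varepsilon}$: perfect matching with $(v+2\varepsilon)/4$ edges $+1$ and $(v-2\varepsilon)/4$ edges $-1$; $H^1_{v,\varepsilon}$: disjoint union of a $K_{1,3}$ with two $+1$ and one $-1$ edge and a matching of the other $v-4$ vertices with $(v-6+2\varepsilon)/4$ edges $+1$, $(v-2-2\varepsilon)/4$ edges $-1$; $H^2_{v,\varepsilon}$: disjoint union of a $K_{1,3}$ with one $+1$ and two $-1$ edges and a matching of the other $v-4$ vertices with $(v-2+2\varepsilon)/4$ edges $+1$, $(v-6-2\varepsilon)/4$ edges $-1$. Nearly 2-balanced: all $\lambda_{x,y}\in\{\lambda-1,\lambda,\lambda+1\}$ and the defect graph is isomorphic to $G_\varepsilon$ under (C1); under (C2) to $H^0_{v,\varepsilon}$ if $\varepsilon\equiv v/2 \pmod 2$, and to $H^1_{v,\varepsilon}$ or $H^2_{v,\varepsilon}$ otherwise. An NWBTS$(v;b)$ is a nearly 2-balanced, 3-balanced TS$(v;b)$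 with $(v,b)$ satisfying (C1) or (C2). -}

module Defs where

open import Data.Empty using (⊥)
open import Data.Fin.Base using (Fin)
open import Data.Fin.Patterns using (0F; 1F; 2F; 3F)
open import Data.Fin.Properties using () renaming (_≟_ to _≟ᶠ_)
open import Data.Fin.Subset using (Subset; ⁅_⁆; _∪_; _∩_) renaming (∣_∣ to #_; _⊆_ to _⊆ˢ_)
open import Data.Fin.Subset.Properties using (_⊆?_)
open import Data.Integer.Base as ℤ using (ℤ; +_; _◃_; _%ℕ_)
import Data.Integer.Divisibility as ℤ
open import Data.List.Base using (List; []; _∷_; length; filter; allFin; cartesianProduct)
open import Data.List.Membership.Propositional using (_∈_)
open import Data.Nat.Base as ℕ using (ℕ; zero; suc; ∣_-_∣; _%_)
open import Data.Nat.Combinatorics using (_C_)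
open import Data.Nat.Divisibility using (_∣_)
import Data.Nat.Properties as ℕ
open import Data.Product.Base using (Σ; ∃-syntax; _×_; _,_; proj₁)
open import Data.Rational.Base as ℚ using (ℚ; 0ℚ; 1ℚ; floor; ceiling; _/_)
import Data.Rational.Properties as ℚ
open import Data.Rational.Solver using (module +-*-Solver)
open import Data.Sign.Base using (Sign) renaming (+ to ⊞; - to ⊟)
open import Data.Sum.Base using (_⊎_; inj₁; inj₂)
open import Function.Bundles using (_↔_; _⇔_; Inverse)
open import Relation.Binary.PropositionalEquality
  using (_≡_; _≢_; refl; sym; trans; cong; cong₂; subst)
open import Relation.Nullary.Decidable using (¬?; _×-dec_)
open import Relation.Nullary.Negation using (¬_)

-- Real numbers as Cauchy sequences of rationals.  Two sequences x, y
-- denote the same real when x ≤ᴿ y and y ≤ᴿ x; nothing below depends on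
-- the choice of representative.

Cauchy : (ℕ → ℚ) → Set
Cauchy x = ∀ δ → 0ℚ ℚ.< δ →
  ∃[ N ] (∀ m n → N ℕ.≤ m → N ℕ.≤ n → ℚ.∣ x m ℚ.- x n ∣ ℚ.≤ δ)

record ℝ : Set where
  constructor mkℝ
  field
    seq    : ℕ → ℚ
    cauchy : Cauchy seq

open ℝ public

infix  4 _≤ᴿ_
infixl 6 _+ᴿ_
infixl 7 _*ᴿ_
infixr 8 _^ᴿ_

_≤ᴿ_ : ℝ → ℝ → Set
x ≤ᴿ y = ∀ δ → 0ℚ ℚ.< δ →
  ∃[ N ] (∀ n → N ℕ.≤ n → seq x n ℚ.≤ seq y n ℚ.+ δ)

fromℚ : ℚ → ℝ
fromℚ q = mkℝ (λ _ → q) λ δ 0<δ → 0 , λ _ _ _ _ →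
  subst (ℚ._≤ δ) (sym (cong ℚ.∣_∣ (ℚ.+-inverseʳ q))) (ℚ.<⇒≤ 0<δ)

fromℕ : ℕ → ℝ
fromℕ n = fromℚ (+ n / 1)

1ᴿ : ℝ
1ᴿ = fromℕ 1

private
  module S = +-*-Solver

  split : ∀ p q δ → 0ℚ ℚ.< p → 0ℚ ℚ.< q → 0ℚ ℚ.< δ →
          ∃[ w ] (0ℚ ℚ.< w × p ℚ.* w ℚ.+ q ℚ.* w ≡ δ)
  split p q δ 0<p 0<q 0<δ = w , ℚ.positive⁻¹ w {{w-pos}} , eq
    where
    r = p ℚ.+ q
    instance
      r-pos : ℚ.Positive r
      r-pos = ℚ.pos+pos⇒pos p {{ℚ.positive 0<p}} q {{ℚ.positive 0<q}}
      r-nz : ℚ.NonZero r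
      r-nz = ℚ.pos⇒nonZero r
    w = ℚ.1/ r ℚ.* δ
    w-pos : ℚ.Positive w
    w-pos = ℚ.pos*pos⇒pos (ℚ.1/ r) {{ℚ.1/pos⇒pos r}} δ {{ℚ.positive 0<δ}}
    eq : p ℚ.* w ℚ.+ q ℚ.* w ≡ δ
    eq = trans (sym (ℚ.*-distribʳ-+ w p q))
        (trans (sym (ℚ.*-assoc r (ℚ.1/ r) δ))
        (trans (cong (ℚ._* δ) (ℚ.*-inverseʳ r)) (ℚ.*-identityˡ δ)))

  bounded : ∀ x → Cauchy x →
            ∃[ B ] (0ℚ ℚ.< B × ∃[ N ] (∀ n → N ℕ.≤ n → ℚ.∣ x n ∣ ℚ.≤ B))
  bounded x cx with cx 1ℚ (ℚ.positive⁻¹ 1ℚ)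
  ... | N , close = 1ℚ ℚ.+ ℚ.∣ x N ∣
      , ℚ.+-mono-<-≤ (ℚ.positive⁻¹ 1ℚ) (ℚ.0≤∣p∣ (x N))
      , N , λ n N≤n →
          subst (λ t → ℚ.∣ t ∣ ℚ.≤ 1ℚ ℚ.+ ℚ.∣ x N ∣)
            (S.solve 2 (λ a b → (a S.:- b) S.:+ b S.:= a) refl (x n) (x N))
            (ℚ.≤-trans (ℚ.∣p+q∣≤∣p∣+∣q∣ (x n ℚ.- x N) (x N))
                       (ℚ.+-monoˡ-≤ ℚ.∣ x N ∣ (close n N N≤n ℕ.≤-refl)))

  *-mono : ∀ a b A B → ℚ.∣ a ∣ ℚ.≤ A → ℚ.∣ b ∣ ℚ.≤ B → 0ℚ ℚ.< A →
           ℚ.∣ a ℚ.* b ∣ ℚ.≤ A ℚ.* B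
  *-mono a b A B a≤A b≤B 0<A = ℚ.≤-trans (ℚ.≤-reflexive (ℚ.∣p*q∣≡∣p∣*∣q∣ a b))
    (ℚ.≤-trans (ℚ.*-monoʳ-≤-nonNeg ℚ.∣ b ∣ {{ℚ.∣-∣-nonNeg b}} a≤A)
               (ℚ.*-monoˡ-≤-nonNeg A {{ℚ.nonNegative (ℚ.<⇒≤ 0<A)}} b≤B))

_+ᴿ_ : ℝ → ℝ → ℝ
mkℝ x cx +ᴿ mkℝ y cy = mkℝ (λ n → x n ℚ.+ y n) λ δ 0<δ →
  let 0<1 = ℚ.positive⁻¹ 1ℚ
      w , 0<w , eq = split 1ℚ 1ℚ δ 0<1 0<1 0<δ
      M , cM = cx w 0<w
      N , cN = cy w 0<w
      w+w≡δ = trans (cong₂ ℚ._+_ (sym (ℚ.*-identityˡ w)) (sym (ℚ.*-identityˡ w))) eq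
  in M ℕ.⊔ N , λ m n h k →
    subst (λ t → ℚ.∣ t ∣ ℚ.≤ δ)
      (S.solve 4 (λ a b c d → (a S.:- b) S.:+ (c S.:- d) S.:= (a S.:+ c) S.:- (b S.:+ d))
        refl (x m) (x n) (y m) (y n))
      (ℚ.≤-trans (ℚ.∣p+q∣≤∣p∣+∣q∣ (x m ℚ.- x n) (y m ℚ.- y n))
        (ℚ.≤-trans
          (ℚ.+-mono-≤ (cM m n (ℕ.m⊔n≤o⇒m≤o M N h) (ℕ.m⊔n≤o⇒m≤o M N k))
                      (cN m n (ℕ.m⊔n≤o⇒n≤o M N h) (ℕ.m⊔n≤o⇒n≤o M N k)))
          (ℚ.≤-reflexive w+w≡δ)))

_*ᴿ_ : ℝ → ℝ → ℝ
mkℝ x cx *ᴿ mkℝ y cy = mkℝ (λ n → x n ℚ.* y n) λ δ 0<δ →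
  let A , 0<A , M₀ , bx = bounded x cx
      B , 0<B , N₀ , by = bounded y cy
      w , 0<w , eq = split A B δ 0<A 0<B 0<δ
      M₁ , cM = cx w 0<w
      N₁ , cN = cy w 0<w
      K  = M₀ ℕ.⊔ N₀
      K′ = M₁ ℕ.⊔ N₁
  in K ℕ.⊔ K′ , λ m n h k →
    let hm = ℕ.m⊔n≤o⇒m≤o K K′ h
        h′ = ℕ.m⊔n≤o⇒n≤o K K′ h
        kn = ℕ.m⊔n≤o⇒m≤o K K′ k
        k′ = ℕ.m⊔n≤o⇒n≤o K K′ k
    in subst (λ t → ℚ.∣ t ∣ ℚ.≤ δ)
      (S.solve 4 (λ a b c d → a S.:* (c S.:- d) S.:+ d S.:* (a S.:- b)
                              S.:= a S.:* c S.:- b S.:* d)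
        refl (x m) (x n) (y m) (y n))
      (ℚ.≤-trans (ℚ.∣p+q∣≤∣p∣+∣q∣ (x m ℚ.* (y m ℚ.- y n)) (y n ℚ.* (x m ℚ.- x n)))
        (ℚ.≤-trans
          (ℚ.+-mono-≤
            (*-mono (x m) (y m ℚ.- y n) A w (bx m (ℕ.m⊔n≤o⇒m≤o M₀ N₀ hm))
              (cN m n (ℕ.m⊔n≤o⇒n≤o M₁ N₁ h′) (ℕ.m⊔n≤o⇒n≤o M₁ N₁ k′)) 0<A)
            (*-mono (y n) (x m ℚ.- x n) B w (by n (ℕ.m⊔n≤o⇒n≤o M₀ N₀ kn))
              (cM m n (ℕ.m⊔n≤o⇒m≤o M₁ N₁ h′) (ℕ.m⊔n≤o⇒m≤o M₁ N₁ k′)) 0<B))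
          (ℚ.≤-reflexive eq)))

_^ᴿ_ : ℝ → ℕ → ℝ
x ^ᴿ zero  = 1ᴿ
x ^ᴿ suc n = x *ᴿ x ^ᴿ n

-- The multiset of blocks is a family indexed by Fin b, so repeated blocks are allowed.

Block : ℕ → Set
Block v = Σ (Subset v) λ B → # B ≡ 3

record TS (v b : ℕ) : Set where
  field
    v≥3   : 3 ℕ.≤ v
    block : Fin b → Block v

  pts : Fin b → Subset v
  pts i = proj₁ (block i)

open TS public

module _ {v b : ℕ} where

  -- meet 𝓕 j is v_j: the blocks are compared as members of the family,
  -- so two copies of a repeated block contribute to v_3.
  meet : TS v b → ℕ → ℕ
  meet 𝓕 j = length (filter
    (λ (i , i′) → ¬? (i ≟ᶠ i′) ×-dec (# (pts 𝓕 i ∩ pts 𝓕 i′) ℕ.≟ j))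
    (cartesianProduct (allFin b) (allFin b)))

  P : TS v b → ℝ → ℝ
  P 𝓕 x = fromℕ (meet 𝓕 0) *ᴿ x ^ᴿ 0
       +ᴿ fromℕ (meet 𝓕 1) *ᴿ x ^ᴿ 1
       +ᴿ fromℕ (meet 𝓕 2) *ᴿ x ^ᴿ 2
       +ᴿ fromℕ (meet 𝓕 3) *ᴿ x ^ᴿ 3

  OptimalDataPlacement : TS v b → Set
  OptimalDataPlacement 𝓕 = ∀ (𝓕′ : TS v b) (x : ℝ) → 1ᴿ ≤ᴿ x → P 𝓕 x ≤ᴿ P 𝓕′ x

  -- λ_{x₁,…,xⱼ} is degree 𝓕 S for S = {x₁,…,xⱼ}.
  degree : TS v b → Subset v → ℕ
  degree 𝓕 S = length (filter (λ i → S ⊆? pts 𝓕 i) (allFin b))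

  degree₂ : TS v b → Fin v → Fin v → ℕ
  degree₂ 𝓕 x y = degree 𝓕 (⁅ x ⁆ ∪ ⁅ y ⁆)

  Balanced : ℕ → TS v b → Set
  Balanced j 𝓕 = ∀ S T → # S ≡ j → # T ≡ j → ∣ degree 𝓕 S - degree 𝓕 T ∣ ℕ.≤ 1

-- Below, l stands for λ.

AssociatedPair : (v b : ℕ) → ℤ → ℤ → Set
AssociatedPair v b l ε =
    + (3 ℕ.* b) ≡ l ℤ.* + (v C 2) ℤ.+ ε
  × ℚ.- (+ v / 2) ℚ.< ε / 1
  × ε / 1 ℚ.< + v / 2

lv[v-1]/6 : ℤ → ℕ → ℚ
lv[v-1]/6 l v = (l ℤ.* + v ℤ.* (+ v ℤ.- + 1)) / 6

C1 : ℕ → ℕ → Set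
C1 v b = v % 3 ≡ 2 × ∃[ l ]
  ( (+ b ≡ floor (lv[v-1]/6 l v) ⊎ + b ≡ ceiling (lv[v-1]/6 l v))
  × (v % 6 ≡ 5 → l %ℕ 3 ≡ 1 ⊎ l %ℕ 3 ≡ 2)
  × (v % 6 ≡ 2 → l %ℕ 6 ≡ 2 ⊎ l %ℕ 6 ≡ 4))

C2 : ℕ → ℕ → Set
C2 v b = 2 ∣ v × ∃[ l ]
  ( l %ℕ 2 ≡ 1
  × lv[v-1]/6 l v ℚ.- + v / 6 ℚ.< + b / 1
  × + b / 1 ℚ.< lv[v-1]/6 l v ℚ.+ + v / 6)

-- Edge ⊞ is the set of edges labelled +1, Edge ⊟ of those labelled -1.
record SignedGraph : Set₁ where
  field
    Vertex : Set
    Edge   : Sign → Vertex → Vertex → Set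

open SignedGraph public

record _≅_ (G H : SignedGraph) : Set where
  field
    bijection : Vertex G ↔ Vertex H
    preserves : ∀ s x y →
      Edge G s x y ⇔ Edge H s (Inverse.to bijection x) (Inverse.to bijection y)

infix  4 _≅_
infixr 6 _⊕_
infixr 7 _⊗_

-- Each undirected edge is listed once, in either direction.
fromEdges : ∀ n → List (Sign × Fin n × Fin n) → SignedGraph
fromEdges n es = record
  { Vertex = Fin n
  ; Edge   = λ s x y → (s , x , y) ∈ es ⊎ (s , y , x) ∈ es
  }

_⊕_ : SignedGraph → SignedGraph → SignedGraph
G ⊕ H = record { Vertex = Vertex G ⊎ Vertex H ; Edge = E }
  where
  E : Sign → Vertex G ⊎ Vertex H → Vertex G ⊎ Vertex H → Set
  E s (inj₁ x) (inj₁ y) = Edge G s x y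
  E s (inj₂ x) (inj₂ y) = Edge H s x y
  E s (inj₁ _) (inj₂ _) = ⊥
  E s (inj₂ _) (inj₁ _) = ⊥

_⊗_ : ℕ → SignedGraph → SignedGraph
n ⊗ G = record
  { Vertex = Fin n × Vertex G
  ; Edge   = λ s (i , x) (j , y) → i ≡ j × Edge G s x y
  }

isolated : ℕ → SignedGraph
isolated n = fromEdges n []

K₂ : Sign → SignedGraph
K₂ s = fromEdges 2 ((s , 0F , 1F) ∷ [])

triangle : Sign → Sign → Sign → SignedGraph
triangle s t u = fromEdges 3 ((s , 0F , 1F) ∷ (t , 1F , 2F) ∷ (u , 2F , 0F) ∷ [])

4-cycle : Sign → Sign → Sign → Sign → SignedGraph
4-cycle s t u w =
  fromEdges 4 ((s , 0F , 1F) ∷ (t , 1F , 2F) ∷ (u , 2F , 3F) ∷ (w , 3F , 0F) ∷ [])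

K₁,₃ : Sign → Sign → Sign → SignedGraph
K₁,₃ s t u = fromEdges 4 ((s , 0F , 1F) ∷ (t , 0F , 2F) ∷ (u , 0F , 3F) ∷ [])

matching : (p q : ℕ) → SignedGraph
matching p q = p ⊗ K₂ ⊞ ⊕ q ⊗ K₂ ⊟

G₁ G₋₁ G₂ G₋₂ : SignedGraph
G₁  = triangle ⊞ ⊞ ⊟
G₋₁ = triangle ⊞ ⊟ ⊟
G₂  = 4-cycle ⊞ ⊞ ⊞ ⊟
G₋₂ = 4-cycle ⊞ ⊟ ⊟ ⊟

-- D is isomorphic to G_ε; as D has all v points as vertices, G_ε is
-- completed by isolated vertices.
IsoG : ℕ → ℤ → SignedGraph → Set
IsoG v ε D =
    (ε ≡ + 1     × D ≅ G₁  ⊕ isolated (v ℕ.∸ 3))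
  ⊎ (ε ≡ ℤ.- + 1 × D ≅ G₋₁ ⊕ isolated (v ℕ.∸ 3))
  ⊎ (ε ≡ + 2     × D ≅ G₂  ⊕ isolated (v ℕ.∸ 4))
  ⊎ (ε ≡ ℤ.- + 2 × D ≅ G₋₂ ⊕ isolated (v ℕ.∸ 4))

-- In IsoH⁰, IsoH¹, IsoH² the numbers p and q of matching edges labelled
-- +1 and -1 are given by fractions with denominator 4; H^i_{v,ε} is
-- defined only when these are natural numbers.
IsoH⁰ IsoH¹ IsoH² : ℕ → ℤ → SignedGraph → Set
IsoH⁰ v ε D = ∃[ p ] ∃[ q ]
  ( + (4 ℕ.* p) ≡ + v ℤ.+ + 2 ℤ.* ε
  × + (4 ℕ.* q) ≡ + v ℤ.- + 2 ℤ.* ε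
  × D ≅ matching p q)
IsoH¹ v ε D = ∃[ p ] ∃[ q ]
  ( + (4 ℕ.* p) ≡ + v ℤ.- + 6 ℤ.+ + 2 ℤ.* ε
  × + (4 ℕ.* q) ≡ + v ℤ.- + 2 ℤ.- + 2 ℤ.* ε
  × D ≅ K₁,₃ ⊞ ⊞ ⊟ ⊕ matching p q)
IsoH² v ε D = ∃[ p ] ∃[ q ]
  ( + (4 ℕ.* p) ≡ + v ℤ.- + 2 ℤ.+ + 2 ℤ.* ε
  × + (4 ℕ.* q) ≡ + v ℤ.- + 6 ℤ.- + 2 ℤ.* ε
  × D ≅ K₁,₃ ⊞ ⊟ ⊟ ⊕ matching p q)

module _ {v b : ℕ} where

  defectGraph : TS v b → ℤ → SignedGraph
  defectGraph 𝓕 l = record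
    { Vertex = Fin v
    ; Edge   = λ s x y → x ≢ y × + degree₂ 𝓕 x y ≡ l ℤ.+ (s ◃ 1)
    }

  record NearlyTwoBalanced (𝓕 : TS v b) : Set where
    field
      l ε        : ℤ
      associated : AssociatedPair v b l ε
      near       : ∀ x y → x ≢ y →
        let d = + degree₂ 𝓕 x y in d ≡ l ℤ.- + 1 ⊎ d ≡ l ⊎ d ≡ l ℤ.+ + 1

    D : SignedGraph
    D = defectGraph 𝓕 l

    ε≡v/2[mod2] : Set
    ε≡v/2[mod2] = + 2 ℤ.∣ ε ℤ.- + (v ℕ./ 2)

    field
      underC1 : C1 v b → IsoG v ε D
      underC2 : C2 v b → (ε≡v/2[mod2] → IsoH⁰ v ε D)
                       × (¬ ε≡v/2[mod2] → IsoH¹ v ε D ⊎ IsoH² v ε D)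

  record NWBTS (𝓕 : TS v b) : Set where
    field
      conditions        : C1 v b ⊎ C2 v b
      nearlyTwoBalanced : NearlyTwoBalanced 𝓕
      threeBalanced     : Balanced 3 𝓕

{-# OPTIONS --safe #-}

-- Write x = 1 + y. The coefficient of yᵏ in P(𝓕, x) is Σ C(|Bᵢ ∩ Bᵢ′|, k) over ordered pairs i ≠ i′,
-- which equals Σ λ_S² - C(3, k) b over the k-subsets S. So it is enough that an NWBTS minimises Σ λ_S²
-- for each k ≤ 3. For k ≠ 2 this is balance, since Σ λ_S = C(3, k) b is fixed; 1-balance holds because
-- the signed degrees of every possible defect graph take at most two values, c and c + 2.
-- For k = 2 put δ_xy = λ_xy - λ, also for the competitor 𝓕′: the total of δ is ε for both systems, so it
-- is enough to compare E = Σ δ², and E ≡ ε (mod 2). The row sums of δ are 2 r_x - λ(v - 1), hence all have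
-- the parity of c. If c is odd, every row has a nonzero entry, so 2E′ ≥ v, while 2E ≤ v + 2 for the graphs H.
-- If c is even and ε ≠ 0, then 2E′ ≥ 6, while 2E ≤ 8 for the graphs G. In both cases E ≤ E′ + 1, and
-- the parity of E - E′ gives E ≤ E′.

module Submission where

open import Defs
open import Algebra.Bundles using (AbelianGroup)
open import Data.Bool.Base using (if_then_else_)
open import Data.Fin.Base using (Fin; zero; suc; fromℕ<)
open import Data.Fin.Properties using (all?; any?) renaming (_≟_ to _≟ᶠ_)
open import Data.Fin.Subset using (Subset; inside; outside; ⁅_⁆; _∩_; _∪_; ⊤; ⊥) renaming (∣_∣ to #_)
open import Data.Fin.Subset.Properties
  using (_⊆?_; anySubset?; p∩q⊆p; p∩q⊆q; x∈p∩q⁺; ∩-idem; p⊆q⇒∣p∣≤∣q∣; p⊆p∪q; q⊆p∪q; x∈p∪q⁻;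
         ∪-comm; ∪-idem; ∪-identityˡ; ∪-identityʳ; ⊆⊤; ∣⊤∣≡n)
open import Data.Integer.Base as ℤ
  using (ℤ; +_; +[1+_]; -[1+_]; 0ℤ; 1ℤ; -1ℤ; _+_; _*_; _-_; -_; _≤_; +≤+; _◃_) renaming (suc to sucℤ)
open import Data.Integer.Divisibility.Signed
  using (_∣_; divides; _∣?_; ∣⇒∣ᵤ; ∣ᵤ⇒∣; ∣m∣n⇒∣m+n; ∣m∣n⇒∣m-n; ∣m⇒∣-m)
open import Data.Integer.Properties as ℤ using (module ≤-Reasoning)
open import Data.Integer.Tactic.RingSolver using (solve-∀)
open import Data.List.Base
  using (List; []; _∷_; _++_; map; length; filter; allFin; upTo; cartesianProduct)
open import Data.List.Membership.Propositional using (_∈_)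
import Data.List.Membership.DecPropositional as DecMembership
open import Data.List.Membership.Propositional.Properties
  using (∈-allFin; ∈-upTo⁺; ∈-map⁺; ∈-map⁻; ∈-++⁺ˡ; ∈-++⁺ʳ; ∈-++⁻; ∈-cartesianProduct⁺)
open import Data.List.Membership.Propositional.Properties.WithK using (unique∧set⇒bag)
open import Data.List.Properties using (length-tabulate; map-tabulate)
open import Data.List.Relation.Binary.BagAndSetEquality using (∼bag⇒↭)
open import Data.List.Relation.Binary.Permutation.Propositional as Perm using (_↭_)
open import Data.List.Relation.Unary.All as All using ([]; _∷_)
open import Data.List.Relation.Unary.AllPairs using ([]; _∷_)
open import Data.List.Relation.Unary.Any using (here; there)
open import Data.List.Relation.Unary.Unique.Propositional using (Unique)
import Data.List.Relation.Unary.Unique.Propositional.Properties as Unique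
open import Data.Nat.Base as ℕ using (ℕ; zero; suc; z≤n; s≤s; ∣_-_∣)
open import Data.Nat.Combinatorics using (_C_; nCk+nC[k+1]≡[n+1]C[k+1])
import Data.Nat.Properties as ℕ
open import Data.Product.Base using (_×_; _,_; ∃-syntax; proj₁; proj₂)
open import Data.Product.Properties using () renaming (≡-dec to ×-≡-dec)
open import Data.Rational.Base as ℚ using (ℚ; 0ℚ; 1ℚ; _/_)
import Data.Rational.Properties as ℚ
open import Data.Rational.Solver using (module +-*-Solver)
open import Data.Rational.Unnormalised.Base as ℚᵘ using (mkℚᵘ; *≡*; *≤*)
import Data.Rational.Unnormalised.Properties as ℚᵘ
open import Data.Sign.Base using (Sign) renaming (+ to ⊞; - to ⊟)
open import Data.Sign.Properties using () renaming (_≟_ to _≟ˢ_)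
open import Data.Sum.Base using (_⊎_; inj₁; inj₂; [_,_]′) renaming (map to ⊎-map)
open import Data.Sum.Properties using (inj₁-injective; inj₂-injective)
open import Data.Vec.Base using ([]; _∷_)
open import Function.Base using (_∘_; id)
open import Function.Bundles using (_↔_; Inverse; Equivalence; mk⇔)
open import Relation.Binary.Definitions using (DecidableEquality)
open import Relation.Binary.PropositionalEquality
  using (_≡_; _≢_; refl; sym; trans; cong; cong₂; subst; subst₂; module ≡-Reasoning)
open import Relation.Nullary.Decidable
  using (Dec; yes; no; does; ¬?; _×-dec_; _⊎-dec_; decidable-stable; from-no;
         True; False; toWitness; toWitnessFalse)
open import Relation.Nullary.Negation using (¬_; contradiction)
open import Relation.Unary using (Pred; Decidable)

open import Algebra.Properties.Group (AbelianGroup.group ℤ.+-0-abelianGroup) using (∙-cancelˡ; ∙-cancelʳ)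
open +-*-Solver using (solve; con; _:=_; _:+_; _:-_; _:*_; :-_)

-- Finite sums of integers

private variable
  A B : Set

-- Only `does` is inspected, so the indicator follows a composite decision by computation;
-- `∑-subsets-⊆` relies on this when `_⊆?_` steps past the first point.
𝟙 : Dec A → ℤ
𝟙 a? = if does a? then 1ℤ else 0ℤ

𝟙-yes : (a? : Dec A) → A → 𝟙 a? ≡ 1ℤ
𝟙-yes (yes _) a = refl
𝟙-yes (no ¬a) a = contradiction a ¬a

𝟙-no : (a? : Dec A) → ¬ A → 𝟙 a? ≡ 0ℤ
𝟙-no (yes a) ¬a = contradiction a ¬a
𝟙-no (no _)  ¬a = refl

𝟙-⇔ : (a? : Dec A) (b? : Dec B) → (A → B) → (B → A) → 𝟙 a? ≡ 𝟙 b?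
𝟙-⇔ (yes a) b? f g = sym (𝟙-yes b? (f a))
𝟙-⇔ (no ¬a) b? f g = sym (𝟙-no b? (¬a ∘ g))

𝟙-× : (a? : Dec A) (b? : Dec B) → 𝟙 (a? ×-dec b?) ≡ 𝟙 a? * 𝟙 b?
𝟙-× (yes _) (yes _) = refl
𝟙-× (yes _) (no _)  = refl
𝟙-× (no _)  _       = refl

𝟙-¬ : (a? : Dec A) → 𝟙 (¬? a?) ≡ 1ℤ - 𝟙 a?
𝟙-¬ (yes _) = refl
𝟙-¬ (no _)  = refl

infix 7 ∑
syntax ∑ xs (λ x → e) = ∑[ x ∈ xs ] e

∑ : List A → (A → ℤ) → ℤ
∑ []       f = 0ℤ
∑ (x ∷ xs) f = f x + ∑ xs f

∑-cong-∈ : ∀ xs {f g : A → ℤ} → (∀ x → x ∈ xs → f x ≡ g x) → ∑ xs f ≡ ∑ xs g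
∑-cong-∈ []       e = refl
∑-cong-∈ (x ∷ xs) e = cong₂ _+_ (e x (here refl)) (∑-cong-∈ xs λ y → e y ∘ there)

∑-cong : ∀ (xs : List A) {f g : A → ℤ} → (∀ x → f x ≡ g x) → ∑ xs f ≡ ∑ xs g
∑-cong xs e = ∑-cong-∈ xs λ x _ → e x

∑-mono : ∀ (xs : List A) {f g : A → ℤ} → (∀ x → f x ≤ g x) → ∑ xs f ≤ ∑ xs g
∑-mono []       e = ℤ.≤-refl
∑-mono (x ∷ xs) e = ℤ.+-mono-≤ (e x) (∑-mono xs e)

∑-0 : ∀ (xs : List A) → ∑[ x ∈ xs ] 0ℤ ≡ 0ℤ
∑-0 []       = refl
∑-0 (x ∷ xs) = trans (ℤ.+-identityˡ _) (∑-0 xs)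

∑-zero : ∀ (xs : List A) {f : A → ℤ} → (∀ x → f x ≡ 0ℤ) → ∑ xs f ≡ 0ℤ
∑-zero xs e = trans (∑-cong xs e) (∑-0 xs)

∑-nonNeg : ∀ (xs : List A) {f : A → ℤ} → (∀ x → 0ℤ ≤ f x) → 0ℤ ≤ ∑ xs f
∑-nonNeg xs e = ℤ.≤-trans (ℤ.≤-reflexive (sym (∑-0 xs))) (∑-mono xs e)

∑-+ : ∀ (xs : List A) (f g : A → ℤ) → ∑[ x ∈ xs ] (f x + g x) ≡ ∑ xs f + ∑ xs g
∑-+ []       f g = refl
∑-+ (x ∷ xs) f g rewrite ∑-+ xs f g = interchange (f x) (g x) (∑ xs f) (∑ xs g)
  where
  interchange : ∀ a b c d → a + b + (c + d) ≡ a + c + (b + d)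
  interchange = solve-∀

∑-*ˡ : ∀ (xs : List A) c (f : A → ℤ) → ∑[ x ∈ xs ] (c * f x) ≡ c * ∑ xs f
∑-*ˡ []       c f = sym (ℤ.*-zeroʳ c)
∑-*ˡ (x ∷ xs) c f rewrite ∑-*ˡ xs c f = sym (ℤ.*-distribˡ-+ c (f x) (∑ xs f))

∑-*ʳ : ∀ (xs : List A) c (f : A → ℤ) → ∑[ x ∈ xs ] (f x * c) ≡ ∑ xs f * c
∑-*ʳ xs c f = trans (∑-cong xs λ x → ℤ.*-comm (f x) c)
             (trans (∑-*ˡ xs c f) (ℤ.*-comm c (∑ xs f)))

∑-- : ∀ (xs : List A) (f g : A → ℤ) → ∑[ x ∈ xs ] (f x - g x) ≡ ∑ xs f - ∑ xs g
∑-- xs f g = trans (∑-+ xs f (λ x → - g x)) (cong (λ t → ∑ xs f + t)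
  (trans (∑-cong xs λ x → sym (ℤ.-1*i≡-i (g x)))
  (trans (∑-*ˡ xs -1ℤ g) (ℤ.-1*i≡-i _))))

∑-const : ∀ (xs : List A) c → ∑[ x ∈ xs ] c ≡ + length xs * c
∑-const []       c = refl
∑-const (x ∷ xs) c rewrite ∑-const xs c = sym (ℤ.suc-* (+ length xs) c)

∑-swap : ∀ (xs : List A) (ys : List B) (f : A → B → ℤ) →
         ∑[ x ∈ xs ] (∑[ y ∈ ys ] f x y) ≡ ∑[ y ∈ ys ] (∑[ x ∈ xs ] f x y)
∑-swap []       ys f = sym (∑-0 ys)
∑-swap (x ∷ xs) ys f = trans (cong (λ t → ∑ ys (f x) + t) (∑-swap xs ys f)) (sym (∑-+ ys (f x) _))

∑-map : ∀ (g : A → B) xs (f : B → ℤ) → ∑ (map g xs) f ≡ ∑[ x ∈ xs ] f (g x)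
∑-map g []       f = refl
∑-map g (x ∷ xs) f = cong (λ t → f (g x) + t) (∑-map g xs f)

∑-++ : ∀ xs ys (f : A → ℤ) → ∑ (xs ++ ys) f ≡ ∑ xs f + ∑ ys f
∑-++ []       ys f = sym (ℤ.+-identityˡ _)
∑-++ (x ∷ xs) ys f = trans (cong (λ t → f x + t) (∑-++ xs ys f)) (sym (ℤ.+-assoc (f x) _ _))

∑-cartesianProduct : ∀ xs ys (f : A × B → ℤ) →
  ∑ (cartesianProduct xs ys) f ≡ ∑[ x ∈ xs ] (∑[ y ∈ ys ] f (x , y))
∑-cartesianProduct []       ys f = refl
∑-cartesianProduct (x ∷ xs) ys f = trans (∑-++ (map (x ,_) ys) _ f)
  (cong₂ _+_ (∑-map (x ,_) ys f) (∑-cartesianProduct xs ys f))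

∑-↭ : ∀ {xs ys : List A} (f : A → ℤ) → xs ↭ ys → ∑ xs f ≡ ∑ ys f
∑-↭ f Perm.refl          = refl
∑-↭ f (Perm.prep x p)    = cong (λ t → f x + t) (∑-↭ f p)
∑-↭ f (Perm.swap {xs} {ys} x y p) =
  trans (cong (λ t → f x + (f y + t)) (∑-↭ f p)) (exchange (f x) (f y) (∑ ys f))
  where
  exchange : ∀ a b c → a + (b + c) ≡ b + (a + c)
  exchange = solve-∀
∑-↭ f (Perm.trans p q)   = trans (∑-↭ f p) (∑-↭ f q)

length-filter : ∀ {P : Pred A _} (P? : Decidable P) xs →
                + length (filter P? xs) ≡ ∑[ x ∈ xs ] 𝟙 (P? x)
length-filter P? []       = refl
length-filter P? (x ∷ xs) with P? x
... | yes _ = cong sucℤ (length-filter P? xs)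
... | no  _ = trans (length-filter P? xs) (sym (ℤ.+-identityˡ _))

-- Since `xs` has no repetition, `x` is met exactly once, and every other term carries the factor 0.
∑-δ : (_≟_ : DecidableEquality A) → ∀ {xs} → Unique xs → ∀ {x} → x ∈ xs → (f : A → ℤ) →
      ∑[ y ∈ xs ] (𝟙 (x ≟ y) * f y) ≡ f x
∑-δ _≟_ {x ∷ xs} (x∉ ∷ u) (here refl) f = trans (cong₂ _+_
    (trans (cong (_* f x) (𝟙-yes (x ≟ x) refl)) (ℤ.*-identityˡ _))
    (trans (∑-cong-∈ xs λ y y∈ → cong (_* f y) (𝟙-no (x ≟ y) (All.lookup x∉ y∈))) (∑-0 xs)))
  (ℤ.+-identityʳ _)
∑-δ _≟_ {z ∷ xs} (z∉ ∷ u) {x} (there x∈) f = trans (cong₂ _+_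
    (cong (_* f z) (𝟙-no (x ≟ z) (All.lookup z∉ x∈ ∘ sym))) (∑-δ _≟_ u x∈ f))
  (ℤ.+-identityˡ _)

-- Subsets of a given size

∑-allFin-suc : ∀ {n} (f : Fin (suc n) → ℤ) →
               ∑ (allFin (suc n)) f ≡ f zero + (∑[ x ∈ allFin n ] f (suc x))
∑-allFin-suc {n} f = cong (λ t → f zero + t)
  (trans (cong (λ xs → ∑ xs f) (sym (map-tabulate id suc))) (∑-map suc (allFin n) f))

subsets : ∀ n → ℕ → List (Subset n)
subsets zero    zero    = [] ∷ []
subsets zero    (suc k) = []
subsets (suc n) zero    = map (outside ∷_) (subsets n zero)
subsets (suc n) (suc k) = map (inside ∷_) (subsets n k) ++ map (outside ∷_) (subsets n (suc k))

∈-subsets⇒# : ∀ n k {S} → S ∈ subsets n k → # S ≡ k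
∈-subsets⇒# zero    zero    (here refl) = refl
∈-subsets⇒# (suc n) zero    S∈ with ∈-map⁻ (outside ∷_) S∈
... | _ , S′∈ , refl = ∈-subsets⇒# n zero S′∈
∈-subsets⇒# (suc n) (suc k) S∈ with ∈-++⁻ (map (inside ∷_) (subsets n k)) S∈
... | inj₁ S∈ˡ with _ , S′∈ , refl ← ∈-map⁻ (inside ∷_) S∈ˡ = cong suc (∈-subsets⇒# n k S′∈)
... | inj₂ S∈ʳ with _ , S′∈ , refl ← ∈-map⁻ (outside ∷_) S∈ʳ = ∈-subsets⇒# n (suc k) S′∈

∑-subsets-suc : ∀ n k (f : Subset (suc n) → ℤ) → ∑ (subsets (suc n) (suc k)) f ≡
  (∑[ S ∈ subsets n k ] f (inside ∷ S)) + (∑[ S ∈ subsets n (suc k) ] f (outside ∷ S))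
∑-subsets-suc n k f = trans (∑-++ (map (inside ∷_) (subsets n k)) _ f)
  (cong₂ _+_ (∑-map (inside ∷_) (subsets n k) f) (∑-map (outside ∷_) (subsets n (suc k)) f))

-- Pascal's rule: if the first point lies in `T`, the subsets that contain it and those that avoid
-- it are counted separately; otherwise only the latter remain.
∑-subsets-⊆ : ∀ n k (T : Subset n) → ∑[ S ∈ subsets n k ] 𝟙 (S ⊆? T) ≡ + (# T C k)
∑-subsets-⊆ zero    zero    []            = refl
∑-subsets-⊆ zero    (suc k) []            = refl
∑-subsets-⊆ (suc n) zero    (_ ∷ T)       =
  trans (∑-map (outside ∷_) (subsets n zero) _) (∑-subsets-⊆ n zero T)
∑-subsets-⊆ (suc n) (suc k) (inside ∷ T)  = trans (∑-subsets-suc n k _)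
  (trans (cong₂ _+_ (∑-subsets-⊆ n k T) (∑-subsets-⊆ n (suc k) T))
         (cong +_ (nCk+nC[k+1]≡[n+1]C[k+1] (# T) k)))
∑-subsets-⊆ (suc n) (suc k) (outside ∷ T) = trans (∑-subsets-suc n k _)
  (trans (cong₂ _+_ (∑-0 (subsets n k)) (∑-subsets-⊆ n (suc k) T)) (ℤ.+-identityˡ _))

∑-subsets₀ : ∀ n (f : Subset n → ℤ) → ∑ (subsets n 0) f ≡ f ⊥
∑-subsets₀ zero    f = ℤ.+-identityʳ _
∑-subsets₀ (suc n) f = trans (∑-map (outside ∷_) (subsets n 0) f) (∑-subsets₀ n _)

∑-subsets₁ : ∀ n (f : Subset n → ℤ) → ∑ (subsets n 1) f ≡ ∑[ x ∈ allFin n ] f ⁅ x ⁆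
∑-subsets₁ zero    f = refl
∑-subsets₁ (suc n) f = trans (∑-subsets-suc n 0 f)
  (trans (cong₂ _+_ (∑-subsets₀ n _) (∑-subsets₁ n _)) (sym (∑-allFin-suc (λ x → f ⁅ x ⁆))))

-- The factor 2 is there because the right side runs over ordered pairs. In the induction the pairs
-- with the new point occur twice: as row 0 and as the first entries of the other rows.
∑-subsets₂ : ∀ n (f : Subset n → ℤ) → + 2 * ∑ (subsets n 2) f ≡
  ∑[ x ∈ allFin n ] (∑[ y ∈ allFin n ] (𝟙 (¬? (x ≟ᶠ y)) * f (⁅ x ⁆ ∪ ⁅ y ⁆)))
∑-subsets₂ zero    f = refl
∑-subsets₂ (suc n) f = begin
  + 2 * ∑ (subsets (suc n) 2) f
    ≡⟨ cong (+ 2 *_) (trans (∑-subsets-suc n 1 f) (cong (_+ ∑ (subsets n 2) g) (∑-subsets₁ n _))) ⟩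
  + 2 * (s + ∑ (subsets n 2) g)
    ≡⟨ double s (∑ (subsets n 2) g) ⟩
  -- The leading `0ℤ` is the diagonal entry of row 0; `rowₛ` spreads the second `s` over the rows of
  -- the old points.
  0ℤ + s + (s + + 2 * ∑ (subsets n 2) g)
    ≡⟨ cong₂ _+_ row₀ (cong (λ t → s + t) (∑-subsets₂ n g)) ⟩
  ∑ (allFin (suc n)) (h zero) +
    (s + ∑[ x ∈ allFin n ] (∑[ y ∈ allFin n ] (𝟙 (¬? (x ≟ᶠ y)) * g (⁅ x ⁆ ∪ ⁅ y ⁆))))
    ≡⟨ cong (λ t → ∑ (allFin (suc n)) (h zero) + t)
         (trans (sym (∑-+ (allFin n) _ _)) (∑-cong (allFin n) rowₛ)) ⟩
  ∑ (allFin (suc n)) (h zero) + (∑[ x ∈ allFin n ] (∑ (allFin (suc n)) (h (suc x))))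
    ≡⟨ ∑-allFin-suc (λ x → ∑ (allFin (suc n)) (h x)) ⟨
  ∑[ x ∈ allFin (suc n) ] ∑ (allFin (suc n)) (h x) ∎
  where
  open ≡-Reasoning
  g = λ S → f (outside ∷ S)
  h = λ x y → 𝟙 (¬? (x ≟ᶠ y)) * f (⁅ x ⁆ ∪ ⁅ y ⁆)
  s = ∑[ x ∈ allFin n ] f (inside ∷ ⁅ x ⁆)

  double : ∀ a b → + 2 * (a + b) ≡ 0ℤ + a + (a + + 2 * b)
  double = solve-∀

  row₀ : 0ℤ + s ≡ ∑ (allFin (suc n)) (h zero)
  row₀ = sym (trans (∑-allFin-suc (h zero)) (cong (λ t → 0ℤ + t) (∑-cong (allFin n) λ y →
    trans (ℤ.*-identityˡ _) (cong (λ T → f (inside ∷ T)) (∪-identityˡ ⁅ y ⁆)))))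

  rowₛ : ∀ x → f (inside ∷ ⁅ x ⁆) + (∑[ y ∈ allFin n ] (𝟙 (¬? (x ≟ᶠ y)) * g (⁅ x ⁆ ∪ ⁅ y ⁆))) ≡
               ∑ (allFin (suc n)) (h (suc x))
  rowₛ x = sym (trans (∑-allFin-suc (h (suc x))) (cong (_+ ∑ (allFin n) (λ y → h (suc x) (suc y)))
    (trans (ℤ.*-identityˡ _) (cong (λ T → f (inside ∷ T)) (∪-identityʳ ⁅ x ⁆)))))

#≡0⇒⊥ : ∀ {n} (S : Subset n) → # S ≡ 0 → S ≡ ⊥
#≡0⇒⊥ []            _ = refl
#≡0⇒⊥ (outside ∷ S) e = cong (outside ∷_) (#≡0⇒⊥ S e)

#≡1⇒singleton : ∀ {n} (S : Subset n) → # S ≡ 1 → ∃[ x ] S ≡ ⁅ x ⁆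
#≡1⇒singleton (inside  ∷ S) e = zero , cong (inside ∷_) (#≡0⇒⊥ S (ℕ.suc-injective e))
#≡1⇒singleton (outside ∷ S) e with #≡1⇒singleton S e
... | x , S≡ = suc x , cong (outside ∷_) S≡

0≤i[i-1] : ∀ i → 0ℤ ≤ i * (i - 1ℤ)
0≤i[i-1] (+ 0)     = ℤ.≤-refl
0≤i[i-1] +[1+ n ]  = ℤ.≤-trans (+≤+ z≤n) (ℤ.≤-reflexive (ℤ.pos-* (suc n) n))
0≤i[i-1] -[1+ n ]  = +≤+ z≤n

-- (t - a)(t - a - 1) is nonnegative on ℤ and vanishes at t = a, a + 1; given ∑ f, its sum determines ∑ f².
∑-square-min : ∀ {A : Set} xs (f g : A → ℤ) a →
  (∀ x → x ∈ xs → f x ≡ a ⊎ f x ≡ a + 1ℤ) → ∑ xs f ≡ ∑ xs g →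
  ∑[ x ∈ xs ] (f x * f x) ≤ ∑[ x ∈ xs ] (g x * g x)
∑-square-min xs f g a f∈ ∑f≡∑g = begin
  ∑[ x ∈ xs ] (f x * f x)
    ≡⟨ expand f ⟩
  ∑[ x ∈ xs ] q (f x) + k * ∑ xs f - ∑[ x ∈ xs ] c
    ≡⟨ cong (λ t → t + k * ∑ xs f - ∑[ x ∈ xs ] c)
         (trans (∑-cong-∈ xs λ x x∈ → q≡0 (f∈ x x∈)) (∑-0 xs)) ⟩
  0ℤ + k * ∑ xs f - ∑[ x ∈ xs ] c
    ≡⟨ cong (λ t → 0ℤ + k * t - ∑[ x ∈ xs ] c) ∑f≡∑g ⟩
  0ℤ + k * ∑ xs g - ∑[ x ∈ xs ] c
    ≤⟨ ℤ.+-monoˡ-≤ _ (ℤ.+-monoˡ-≤ _ (∑-nonNeg xs λ x → 0≤i[i-1] (g x - a))) ⟩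
  ∑[ x ∈ xs ] q (g x) + k * ∑ xs g - ∑[ x ∈ xs ] c
    ≡⟨ expand g ⟨
  ∑[ x ∈ xs ] (g x * g x) ∎
  where
  open ≤-Reasoning
  q : ℤ → ℤ
  q t = (t - a) * (t - a - 1ℤ)
  k = + 2 * a + 1ℤ
  c = a * (a + 1ℤ)
  q≡0 : ∀ {t} → t ≡ a ⊎ t ≡ a + 1ℤ → q t ≡ 0ℤ
  q≡0 (inj₁ refl) = left a
    where
    left : ∀ a → (a - a) * (a - a - 1ℤ) ≡ 0ℤ
    left = solve-∀
  q≡0 (inj₂ refl) = right a
    where
    right : ∀ a → (a + 1ℤ - a) * (a + 1ℤ - a - 1ℤ) ≡ 0ℤ
    right = solve-∀
  square : ∀ a t → t * t ≡ (t - a) * (t - a - 1ℤ) + (+ 2 * a + 1ℤ) * t - a * (a + 1ℤ)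
  square = solve-∀
  expand : ∀ h → ∑[ x ∈ xs ] (h x * h x) ≡ ∑[ x ∈ xs ] q (h x) + k * ∑ xs h - ∑[ x ∈ xs ] c
  expand h = trans (∑-cong xs λ x → square a (h x)) (trans (∑-- xs _ _)
    (cong (_- ∑[ x ∈ xs ] c) (trans (∑-+ xs _ _) (cong (λ t → (∑[ x ∈ xs ] q (h x)) + t) (∑-*ˡ xs k h)))))

-- Counting blocks

∣m-n∣≤1⇒m≤1+n : ∀ {m n} → ∣ m - n ∣ ℕ.≤ 1 → m ℕ.≤ suc n
∣m-n∣≤1⇒m≤1+n {m} {n} h = ℕ.≤-trans (ℕ.m≤n+∣m-n∣ m n)
  (ℕ.≤-trans (ℕ.+-monoʳ-≤ n h) (ℕ.≤-reflexive (ℕ.+-comm n 1)))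

n≤m≤1+n⇒m≡n⊎m≡1+n : ∀ {m n} → n ℕ.≤ m → m ℕ.≤ suc n → m ≡ n ⊎ m ≡ suc n
n≤m≤1+n⇒m≡n⊎m≡1+n n≤m m≤1+n with ℕ.m≤n⇒m<n∨m≡n n≤m
... | inj₁ n<m = inj₂ (ℕ.≤-antisym m≤1+n n<m)
... | inj₂ n≡m = inj₁ (sym n≡m)

-- The value `a` is the minimum of `f` on the `k`-subsets. If the sample `S₀` does not attain it,
-- any `S₁` with a smaller value does, because `f S₀` exceeds no value by more than 1.
two-valued : ∀ {n} k (f : Subset n → ℕ) →
  (∀ S T → # S ≡ k → # T ≡ k → ∣ f S - f T ∣ ℕ.≤ 1) →
  ∃[ a ] (∀ S → # S ≡ k → f S ≡ a ⊎ f S ≡ suc a)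
two-valued k f close with anySubset? (λ S → # S ℕ.≟ k)
-- Without subsets of size `k` any value would do.
... | no ∄S = 0 , λ S #S → contradiction (S , #S) ∄S
... | yes (S₀ , #S₀) with anySubset? (λ S → (# S ℕ.≟ k) ×-dec (f S ℕ.<? f S₀))
...   | no ∄S = f S₀ , λ S #S → n≤m≤1+n⇒m≡n⊎m≡1+n
          (ℕ.≮⇒≥ λ fS< → ∄S (S , #S , fS<)) (∣m-n∣≤1⇒m≤1+n (close S S₀ #S #S₀))
...   | yes (S₁ , #S₁ , fS₁<) = f S₁ , λ S #S → n≤m≤1+n⇒m≡n⊎m≡1+n
          (ℕ.s≤s⁻¹ (ℕ.≤-trans fS₁< (∣m-n∣≤1⇒m≤1+n (close S₀ S #S₀ #S))))
          (∣m-n∣≤1⇒m≤1+n (close S S₁ #S #S₁))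

∑-allFin-const : ∀ n c → ∑[ i ∈ allFin n ] c ≡ + n * c
∑-allFin-const n c = trans (∑-const (allFin n) c) (cong (λ m → + m * c) (length-tabulate {n = n} id))

module _ {v b : ℕ} (𝓕 : TS v b) where

  degree≡∑ : ∀ S → + degree 𝓕 S ≡ ∑[ i ∈ allFin b ] 𝟙 (S ⊆? pts 𝓕 i)
  degree≡∑ S = length-filter (λ i → S ⊆? pts 𝓕 i) (allFin b)

  -- Double counting of the inclusions of `S` in blocks: each block has 3 points, hence `3 C k`
  -- subsets of size `k`. The total is the same for every system with `b` blocks.
  ∑-degree : ∀ k → ∑[ S ∈ subsets v k ] + degree 𝓕 S ≡ + b * + (3 C k)
  ∑-degree k = begin
    ∑[ S ∈ subsets v k ] + degree 𝓕 S
      ≡⟨ ∑-cong (subsets v k) degree≡∑ ⟩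
    ∑[ S ∈ subsets v k ] (∑[ i ∈ allFin b ] 𝟙 (S ⊆? pts 𝓕 i))
      ≡⟨ ∑-swap (subsets v k) (allFin b) _ ⟩
    ∑[ i ∈ allFin b ] (∑[ S ∈ subsets v k ] 𝟙 (S ⊆? pts 𝓕 i))
      ≡⟨ ∑-cong (allFin b) (λ i →
           trans (∑-subsets-⊆ v k (pts 𝓕 i)) (cong (λ m → + (m C k)) (proj₂ (block 𝓕 i)))) ⟩
    ∑[ i ∈ allFin b ] + (3 C k)
      ≡⟨ ∑-allFin-const b _ ⟩
    + b * + (3 C k) ∎
    where open ≡-Reasoning

  private
    meetC : ℕ → Fin b → Fin b → ℤ
    meetC k i j = + (# (pts 𝓕 i ∩ pts 𝓕 j) C k)

  -- The square of the degree of `S` counts the ordered pairs of blocks, equal indices included,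
  -- that both contain `S`; for a fixed pair these `S` are the `k`-subsets of the intersection.
  ∑-degree² : ∀ k → ∑[ S ∈ subsets v k ] (+ degree 𝓕 S * + degree 𝓕 S) ≡
                    ∑[ i ∈ allFin b ] (∑[ j ∈ allFin b ] meetC k i j)
  ∑-degree² k = begin
    ∑[ S ∈ subsets v k ] (+ degree 𝓕 S * + degree 𝓕 S)
      ≡⟨ ∑-cong (subsets v k) square ⟩
    ∑[ S ∈ subsets v k ] (∑[ i ∈ allFin b ] (∑[ j ∈ allFin b ] 𝟙 (S ⊆? pts 𝓕 i ∩ pts 𝓕 j)))
      ≡⟨ ∑-swap (subsets v k) (allFin b) _ ⟩
    ∑[ i ∈ allFin b ] (∑[ S ∈ subsets v k ] (∑[ j ∈ allFin b ] 𝟙 (S ⊆? pts 𝓕 i ∩ pts 𝓕 j)))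
      ≡⟨ ∑-cong (allFin b) (λ i → ∑-swap (subsets v k) (allFin b) _) ⟩
    ∑[ i ∈ allFin b ] (∑[ j ∈ allFin b ] (∑[ S ∈ subsets v k ] 𝟙 (S ⊆? pts 𝓕 i ∩ pts 𝓕 j)))
      ≡⟨ ∑-cong (allFin b) (λ i → ∑-cong (allFin b) λ j → ∑-subsets-⊆ v k (pts 𝓕 i ∩ pts 𝓕 j)) ⟩
    ∑[ i ∈ allFin b ] (∑[ j ∈ allFin b ] meetC k i j) ∎
    where
    open ≡-Reasoning
    in-both : ∀ S i j → 𝟙 (S ⊆? pts 𝓕 i) * 𝟙 (S ⊆? pts 𝓕 j) ≡ 𝟙 (S ⊆? pts 𝓕 i ∩ pts 𝓕 j)
    in-both S i j = trans (sym (𝟙-× (S ⊆? pts 𝓕 i) (S ⊆? pts 𝓕 j)))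
      (𝟙-⇔ ((S ⊆? pts 𝓕 i) ×-dec (S ⊆? pts 𝓕 j)) (S ⊆? pts 𝓕 i ∩ pts 𝓕 j)
        (λ (p , q) x∈S → x∈p∩q⁺ (p x∈S , q x∈S))
        (λ S⊆ → (λ x∈S → p∩q⊆p (pts 𝓕 i) (pts 𝓕 j) (S⊆ x∈S)) , λ x∈S → p∩q⊆q (pts 𝓕 i) (pts 𝓕 j) (S⊆ x∈S)))
    square : ∀ S → + degree 𝓕 S * + degree 𝓕 S ≡
                   ∑[ i ∈ allFin b ] (∑[ j ∈ allFin b ] 𝟙 (S ⊆? pts 𝓕 i ∩ pts 𝓕 j))
    square S = trans (cong (_* + degree 𝓕 S) (degree≡∑ S))
      (trans (sym (∑-*ʳ (allFin b) (+ degree 𝓕 S) _)) (∑-cong (allFin b) λ i →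
        trans (cong (𝟙 (S ⊆? pts 𝓕 i) *_) (degree≡∑ S))
        (trans (sym (∑-*ˡ (allFin b) (𝟙 (S ⊆? pts 𝓕 i)) _)) (∑-cong (allFin b) (in-both S i)))))

  -- The coefficient of yᵏ in P 𝓕 (1 + y).
  coefficient : ℕ → ℤ
  coefficient k = ∑[ j ∈ upTo 4 ] (+ (j C k) * + meet 𝓕 j)

  -- The pairs `i ≡ j` counted in `∑-degree²` have to be removed. They contribute `3 C k` per block,
  -- which is common to all competitors, so comparing coefficients means comparing sums of squared
  -- degrees.
  coefficient≡ : ∀ k → coefficient k ≡
    ∑[ S ∈ subsets v k ] (+ degree 𝓕 S * + degree 𝓕 S) - + b * + (3 C k)
  coefficient≡ k = begin
    ∑[ j ∈ upTo 4 ] (+ (j C k) * + meet 𝓕 j)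
      ≡⟨ ∑-cong (upTo 4) (λ j → trans (cong (+ (j C k) *_) (meet≡∑ j)) (trans (sym (∑-*ˡ bb (+ (j C k)) _))
           (∑-cong bb λ p → arrange (+ (j C k)) (w p) (𝟙 (m p ℕ.≟ j))))) ⟩
    ∑[ j ∈ upTo 4 ] (∑[ p ∈ bb ] (w p * (𝟙 (m p ℕ.≟ j) * + (j C k))))
      ≡⟨ ∑-swap (upTo 4) bb (λ j p → w p * (𝟙 (m p ℕ.≟ j) * + (j C k))) ⟩
    ∑[ p ∈ bb ] (∑[ j ∈ upTo 4 ] (w p * (𝟙 (m p ℕ.≟ j) * + (j C k))))
      -- Two blocks meet in at most 3 points, so the size of the intersection occurs in `upTo 4`,
      -- and `∑-δ` selects its binomial coefficient.
      ≡⟨ ∑-cong bb (λ p → trans (∑-*ˡ (upTo 4) (w p) (λ j → 𝟙 (m p ℕ.≟ j) * + (j C k)))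
           (cong (w p *_) (∑-δ ℕ._≟_ (Unique.upTo⁺ 4) (∈-upTo⁺ (s≤s (m≤3 p))) (λ j → + (j C k))))) ⟩
    ∑[ p ∈ bb ] (w p * + (m p C k))
      ≡⟨ ∑-cong bb (λ (i , j) → trans (cong (_* meetC k i j) (𝟙-¬ (i ≟ᶠ j)))
           (distrib (𝟙 (i ≟ᶠ j)) (meetC k i j))) ⟩
    ∑[ (i , j) ∈ bb ] (meetC k i j - 𝟙 (i ≟ᶠ j) * meetC k i j)
      ≡⟨ trans (∑-cartesianProduct (allFin b) (allFin b) _) (∑-cong (allFin b) λ i → ∑-- (allFin b) _ _) ⟩
    ∑[ i ∈ allFin b ] (∑[ j ∈ allFin b ] meetC k i j - ∑[ j ∈ allFin b ] (𝟙 (i ≟ᶠ j) * meetC k i j))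
      ≡⟨ ∑-cong (allFin b) (λ i → cong (λ t → ∑[ j ∈ allFin b ] meetC k i j - t)
           (trans (∑-δ _≟ᶠ_ (Unique.allFin⁺ b) (∈-allFin i) (meetC k i)) (diagonal i))) ⟩
    ∑[ i ∈ allFin b ] (∑[ j ∈ allFin b ] meetC k i j - + (3 C k))
      ≡⟨ trans (∑-- (allFin b) _ _) (cong₂ _-_ (sym (∑-degree² k)) (∑-allFin-const b _)) ⟩
    ∑[ S ∈ subsets v k ] (+ degree 𝓕 S * + degree 𝓕 S) - + b * + (3 C k) ∎
    where
    open ≡-Reasoning
    bb = cartesianProduct (allFin b) (allFin b)
    w : Fin b × Fin b → ℤ
    w (i , j) = 𝟙 (¬? (i ≟ᶠ j))
    m : Fin b × Fin b → ℕ
    m (i , j) = # (pts 𝓕 i ∩ pts 𝓕 j)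
    meet≡∑ : ∀ j → + meet 𝓕 j ≡ ∑[ p ∈ bb ] (w p * 𝟙 (m p ℕ.≟ j))
    meet≡∑ j = trans (length-filter _ bb) (∑-cong bb λ (i , i′) → 𝟙-× (¬? (i ≟ᶠ i′)) (m (i , i′) ℕ.≟ j))
    arrange : ∀ a b c → a * (b * c) ≡ b * (c * a)
    arrange = solve-∀
    distrib : ∀ a b → (1ℤ - a) * b ≡ b - a * b
    distrib = solve-∀
    m≤3 : ∀ p → m p ℕ.≤ 3
    m≤3 (i , j) = subst (m (i , j) ℕ.≤_) (proj₂ (block 𝓕 i)) (p⊆q⇒∣p∣≤∣q∣ (p∩q⊆p (pts 𝓕 i) (pts 𝓕 j)))
    diagonal : ∀ i → meetC k i i ≡ + (3 C k)
    diagonal i = cong (λ m → + (m C k)) (trans (cong #_ (∩-idem (pts 𝓕 i))) (proj₂ (block 𝓕 i)))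

module _ {v b : ℕ} (𝓕 𝓕′ : TS v b) where

  coefficient-mono : ∀ k →
    ∑[ S ∈ subsets v k ] (+ degree 𝓕 S * + degree 𝓕 S) ≤
    ∑[ S ∈ subsets v k ] (+ degree 𝓕′ S * + degree 𝓕′ S) →
    coefficient 𝓕 k ≤ coefficient 𝓕′ k
  coefficient-mono k h = subst₂ _≤_ (sym (coefficient≡ 𝓕 k)) (sym (coefficient≡ 𝓕′ k)) (ℤ.+-monoˡ-≤ _ h)

  balanced⇒coefficient-mono : ∀ k → Balanced k 𝓕 → coefficient 𝓕 k ≤ coefficient 𝓕′ k
  balanced⇒coefficient-mono k bal with two-valued k (degree 𝓕) bal
  ... | a , values = coefficient-mono k (∑-square-min (subsets v k) _ _ (+ a)
    (λ S S∈ → ⊎-map (λ e → cong +_ e) (λ e → trans (cong +_ e) (cong +_ (ℕ.+-comm 1 a)))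
      (values S (∈-subsets⇒# v k S∈)))
    (trans (∑-degree 𝓕 k) (sym (∑-degree 𝓕′ k))))

-- The empty set is the only subset of size 0, so the two degrees coincide.
zero-balanced : ∀ {v b} (𝓕 : TS v b) → Balanced 0 𝓕
zero-balanced 𝓕 S T #S #T rewrite #≡0⇒⊥ S #S | #≡0⇒⊥ T #T =
  ℕ.≤-trans (ℕ.≤-reflexive (ℕ.∣n-n∣≡0 (degree 𝓕 _))) z≤n

-- The defects of a triple system

2∤1 : ¬ (+ 2 ∣ 1ℤ)
2∤1 = from-no (+ 2 ∣? 1ℤ)

2∣n[n+1] : ∀ n → + 2 ∣ + n * (+ n + 1ℤ)
2∣n[n+1] zero    = divides 0ℤ refl
2∣n[n+1] (suc n) with 2∣n[n+1] n
... | divides q eq = divides (q + (+ n + 1ℤ)) (begin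
  + suc n * (+ suc n + 1ℤ)            ≡⟨ expand (+ n) ⟩
  + n * (+ n + 1ℤ) + (+ n + 1ℤ) * + 2 ≡⟨ cong (_+ (+ n + 1ℤ) * + 2) eq ⟩
  q * + 2 + (+ n + 1ℤ) * + 2          ≡⟨ ℤ.*-distribʳ-+ (+ 2) q (+ n + 1ℤ) ⟨
  (q + (+ n + 1ℤ)) * + 2              ∎)
  where
  open ≡-Reasoning
  expand : ∀ i → (1ℤ + i) * (1ℤ + i + 1ℤ) ≡ i * (i + 1ℤ) + (i + 1ℤ) * + 2
  expand = solve-∀

2∣i²-i : ∀ i → + 2 ∣ i * i - i
2∣i²-i (+ zero)  = divides 0ℤ refl
2∣i²-i +[1+ n ]  = subst (+ 2 ∣_) (shift (+ n)) (2∣n[n+1] n)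
  where
  shift : ∀ i → i * (i + 1ℤ) ≡ (1ℤ + i) * (1ℤ + i) - (1ℤ + i)
  shift = solve-∀
2∣i²-i -[1+ n ]  = subst (+ 2 ∣_) (shift (+ suc n)) (2∣n[n+1] (suc n))
  where
  shift : ∀ i → i * (i + 1ℤ) ≡ - i * - i - - i
  shift = solve-∀

∣-∑ : ∀ {A : Set} {k} (xs : List A) {f : A → ℤ} → (∀ x → k ∣ f x) → k ∣ ∑ xs f
∣-∑ []       h = divides 0ℤ refl
∣-∑ (x ∷ xs) h = ∣m∣n⇒∣m+n (h x) (∣-∑ xs h)

-- Termwise, a square has the parity of its base. This serves both for a single row of defects and
-- for the defects of a whole system.
2∣∑f²-∑f : ∀ {A : Set} (xs : List A) f → + 2 ∣ ∑[ x ∈ xs ] (f x * f x) - ∑ xs f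
2∣∑f²-∑f xs f = subst (+ 2 ∣_) (∑-- xs _ f) (∣-∑ xs (2∣i²-i ∘ f))

0≤i*i : ∀ i → 0ℤ ≤ i * i
0≤i*i (+ n)    = subst (0ℤ ≤_) (ℤ.pos-* n n) (+≤+ z≤n)
0≤i*i -[1+ n ] = +≤+ z≤n

0≤i⇒i≢0⇒1≤i : ∀ {i} → 0ℤ ≤ i → i ≢ 0ℤ → 1ℤ ≤ i
0≤i⇒i≢0⇒1≤i 0≤i i≢0 = ℤ.i<j⇒suc[i]≤j (ℤ.≤∧≢⇒< 0≤i (i≢0 ∘ sym))

1≤i*i : ∀ {i} → i ≢ 0ℤ → 1ℤ ≤ i * i
1≤i*i {i} i≢0 = 0≤i⇒i≢0⇒1≤i (0≤i*i i) ([ i≢0 , i≢0 ]′ ∘ ℤ.i*j≡0⇒i≡0∨j≡0 i)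

2∣i∧1≤i⇒2≤i : ∀ {i} → + 2 ∣ i → 1ℤ ≤ i → + 2 ≤ i
2∣i∧1≤i⇒2≤i 2∣i 1≤i = ℤ.i<j⇒suc[i]≤j (ℤ.≤∧≢⇒< 1≤i λ { refl → 2∤1 2∣i })

-- Parity rules out the one excess value `1ℤ + j`.
i≤1+j∧2∣i-j⇒i≤j : ∀ {i j} → i ≤ 1ℤ + j → + 2 ∣ i - j → i ≤ j
i≤1+j∧2∣i-j⇒i≤j {i} {j} i≤1+j 2∣i-j with i ℤ.≟ 1ℤ + j
... | no i≢   = subst₂ _≤_ (ℤ.pred-suc i) (ℤ.pred-suc j) (ℤ.pred-mono (ℤ.i<j⇒suc[i]≤j (ℤ.≤∧≢⇒< i≤1+j i≢)))
... | yes refl = contradiction (subst (+ 2 ∣_) (cancel j) 2∣i-j) 2∤1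
  where
  cancel : ∀ j → 1ℤ + j - j ≡ 1ℤ
  cancel = solve-∀

-- Induction on `xs`: the head `x` is paid for by replacing `f` with `g`, which vanishes at `x` and
-- agrees with `f` on the tail because `x` does not recur there.
∑-sublist-≤ : ∀ {n} {xs : List (Fin n)} → Unique xs → (f : Fin n → ℤ) → (∀ x → 0ℤ ≤ f x) →
              ∑ xs f ≤ ∑ (allFin n) f
∑-sublist-≤ {n} []                   f 0≤f = ∑-nonNeg (allFin n) 0≤f
∑-sublist-≤ {n} {x ∷ xs} (x∉ ∷ uniq) f 0≤f = begin
  f x + ∑ xs f
    ≡⟨ cong (λ t → f x + t) (∑-cong-∈ xs λ y y∈ → sym (trans
         (cong (λ t → (1ℤ - t) * f y) (𝟙-no (x ≟ᶠ y) (All.lookup x∉ y∈))) (ℤ.*-identityˡ _))) ⟩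
  f x + ∑ xs g
    ≤⟨ ℤ.+-monoʳ-≤ (f x) (∑-sublist-≤ uniq g 0≤g) ⟩
  f x + ∑ (allFin n) g
    ≡⟨ cong (_+ ∑ (allFin n) g) (∑-δ _≟ᶠ_ (Unique.allFin⁺ n) (∈-allFin x) f) ⟨
  ∑[ y ∈ allFin n ] (𝟙 (x ≟ᶠ y) * f y) + ∑ (allFin n) g
    ≡⟨ ∑-+ (allFin n) _ _ ⟨
  ∑[ y ∈ allFin n ] (𝟙 (x ≟ᶠ y) * f y + g y)
    ≡⟨ ∑-cong (allFin n) (λ y → complement (𝟙 (x ≟ᶠ y)) (f y)) ⟩
  ∑ (allFin n) f ∎
  where
  open ≤-Reasoning
  g : Fin n → ℤ
  g y = (1ℤ - 𝟙 (x ≟ᶠ y)) * f y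
  0≤g : ∀ y → 0ℤ ≤ g y
  0≤g y with x ≟ᶠ y
  ... | yes _ = ℤ.≤-refl
  ... | no  _ = ℤ.≤-trans (0≤f y) (ℤ.≤-reflexive (sym (ℤ.*-identityˡ (f y))))
  complement : ∀ a b → a * b + (1ℤ - a) * b ≡ b
  complement = solve-∀

-- Integer matrices with row sums of given parity

module _ {n : ℕ} (d : Fin n → Fin n → ℤ) where

  rowSum rowSquares : Fin n → ℤ
  rowSum     x = ∑[ y ∈ allFin n ] d x y
  rowSquares x = ∑[ y ∈ allFin n ] (d x y * d x y)

  0≤rowSquares : ∀ x → 0ℤ ≤ rowSquares x
  0≤rowSquares x = ∑-nonNeg (allFin n) λ y → 0≤i*i (d x y)

  entry≤rowSquares : ∀ x y → d x y * d x y ≤ rowSquares x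
  entry≤rowSquares x y = subst (_≤ rowSquares x) (ℤ.+-identityʳ _)
    (∑-sublist-≤ ([] ∷ []) (λ y → d x y * d x y) (λ y → 0≤i*i (d x y)))

  -- Each row contributes at least 1: a row whose squares sum to 0 would have an even sum.
  odd-rows⇒n≤∑squares : (∀ x → ¬ (+ 2 ∣ rowSum x)) → + n ≤ ∑ (allFin n) rowSquares
  odd-rows⇒n≤∑squares odd = subst (_≤ ∑ (allFin n) rowSquares)
    (trans (∑-allFin-const n 1ℤ) (ℤ.*-identityʳ _))
    (∑-mono (allFin n) λ x → 0≤i⇒i≢0⇒1≤i (0≤rowSquares x) λ sq≡0 →
      odd x (subst (+ 2 ∣_) (negate (rowSum x))
        (∣m⇒∣-m (subst (λ t → + 2 ∣ t - rowSum x) sq≡0 (2∣∑f²-∑f (allFin n) (d x))))))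
    where
    negate : ∀ i → - (0ℤ - i) ≡ i
    negate = solve-∀

  module _ (d-sym : ∀ x y → d x y ≡ d y x) (d-diag : ∀ x → d x x ≡ 0ℤ)
           (even : ∀ x → + 2 ∣ rowSum x) where

    private
      -- The squares of the row sum to a positive number, which is even because the row sum is.
      2≤rowSquares : ∀ {x y} → d x y ≢ 0ℤ → + 2 ≤ rowSquares x
      2≤rowSquares {x} {y} dxy≢0 = 2∣i∧1≤i⇒2≤i
        (subst (+ 2 ∣_) (cancel (rowSquares x) (rowSum x)) (∣m∣n⇒∣m+n (2∣∑f²-∑f (allFin n) (d x)) (even x)))
        (ℤ.≤-trans (1≤i*i dxy≢0) (entry≤rowSquares x y))
        where
        cancel : ∀ a b → a - b + b ≡ a
        cancel = solve-∀

      off-diagonal : ∀ {x y} → d x y ≢ 0ℤ → x ≢ y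
      off-diagonal dxy≢0 refl = dxy≢0 (d-diag _)

    -- An even row with a nonzero entry either has a second nonzero entry or an entry divisible by 2.
    even-rows⇒6≤∑squares : ∀ {x y} → d x y ≢ 0ℤ → + 6 ≤ ∑ (allFin n) rowSquares
    even-rows⇒6≤∑squares {x} {y} dxy≢0 with any? (λ z → ¬? (y ≟ᶠ z) ×-dec ¬? (d x z ℤ.≟ 0ℤ))
    -- By symmetry the distinct rows `x`, `y` and `z` all have nonzero entries, and each contributes
    -- at least 2.
    ... | yes (z , y≢z , dxz≢0) = ℤ.≤-trans
      (ℤ.+-mono-≤ (2≤rowSquares dxy≢0) (ℤ.+-mono-≤ (2≤rowSquares (dxy≢0 ∘ trans (d-sym x y)))
        (ℤ.+-monoˡ-≤ 0ℤ (2≤rowSquares (dxz≢0 ∘ trans (d-sym x z))))))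
      (∑-sublist-≤ ((off-diagonal dxy≢0 ∷ off-diagonal dxz≢0 ∷ []) ∷ (y≢z ∷ []) ∷ [] ∷ [])
                   rowSquares 0≤rowSquares)
    -- Now the entry at `y` is the whole row sum, hence even with square at least 4. By symmetry it
    -- counts in rows `x` and `y`, which gives 8.
    ... | no only-y = ℤ.≤-trans (+≤+ (ℕ.s≤s (ℕ.s≤s (ℕ.s≤s (ℕ.s≤s (ℕ.s≤s (ℕ.s≤s z≤n)))))))
      (ℤ.≤-trans (ℤ.+-mono-≤ (ℤ.≤-trans 4≤dxy² (entry≤rowSquares x y))
          (ℤ.+-monoˡ-≤ 0ℤ (ℤ.≤-trans (subst (λ t → + 4 ≤ t * t) (d-sym x y) 4≤dxy²) (entry≤rowSquares y x))))
        (∑-sublist-≤ ((off-diagonal dxy≢0 ∷ []) ∷ [] ∷ []) rowSquares 0≤rowSquares))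
      where
      entry : ∀ z → d x z ≡ 𝟙 (y ≟ᶠ z) * d x z
      entry z with y ≟ᶠ z
      ... | yes _  = sym (ℤ.*-identityˡ _)
      ... | no y≢z = decidable-stable (d x z ℤ.≟ 0ℤ) λ dxz≢0 → only-y (z , y≢z , dxz≢0)
      rowSum≡dxy : rowSum x ≡ d x y
      rowSum≡dxy = trans (∑-cong (allFin n) entry) (∑-δ _≟ᶠ_ (Unique.allFin⁺ n) (∈-allFin y) (d x))
      4≤dxy² : + 4 ≤ d x y * d x y
      4≤dxy² with subst (+ 2 ∣_) rowSum≡dxy (even x)
      ... | divides q dxy≡2q = subst (+ 4 ≤_) (trans (double q) (sym (cong₂ _*_ dxy≡2q dxy≡2q)))
        (ℤ.*-monoˡ-≤-nonNeg (+ 4) (1≤i*i {q} λ { refl → dxy≢0 dxy≡2q }))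
        where
        double : ∀ q → + 4 * (q * q) ≡ q * + 2 * (q * + 2)
        double = solve-∀

-- Pair defects and their totals

module _ {v b : ℕ} (𝓕 : TS v b) (l : ℤ) where

  -- The indicator clears the diagonal, where `degree₂ 𝓕 x x` is the degree of a point and not of a
  -- pair.
  defect : Fin v → Fin v → ℤ
  defect x y = 𝟙 (¬? (x ≟ᶠ y)) * (+ degree₂ 𝓕 x y - l)

  defect-sym : ∀ x y → defect x y ≡ defect y x
  defect-sym x y = cong₂ (λ a S → a * (+ degree 𝓕 S - l))
    (𝟙-⇔ (¬? (x ≟ᶠ y)) (¬? (y ≟ᶠ x)) (_∘ sym) (_∘ sym)) (∪-comm ⁅ x ⁆ ⁅ y ⁆)

  defect-diag : ∀ x → defect x x ≡ 0ℤ
  defect-diag x = cong (_* (+ degree₂ 𝓕 x x - l)) (𝟙-no (¬? (x ≟ᶠ x)) (λ x≢x → x≢x refl))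

  -- The term `y = x` is included, so each block through `x` is counted once for each of its three
  -- points.
  ∑-degree₂ : ∀ x → ∑[ y ∈ allFin v ] + degree₂ 𝓕 x y ≡ + degree 𝓕 ⁅ x ⁆ * + 3
  ∑-degree₂ x = begin
    ∑[ y ∈ allFin v ] + degree₂ 𝓕 x y
      ≡⟨ ∑-cong (allFin v) (λ y → degree≡∑ 𝓕 (⁅ x ⁆ ∪ ⁅ y ⁆)) ⟩
    ∑[ y ∈ allFin v ] (∑[ i ∈ allFin b ] 𝟙 (⁅ x ⁆ ∪ ⁅ y ⁆ ⊆? pts 𝓕 i))
      ≡⟨ ∑-swap (allFin v) (allFin b) _ ⟩
    ∑[ i ∈ allFin b ] (∑[ y ∈ allFin v ] 𝟙 (⁅ x ⁆ ∪ ⁅ y ⁆ ⊆? pts 𝓕 i))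
      ≡⟨ ∑-cong (allFin b) (λ i → trans (∑-cong (allFin v) (split i))
           (trans (∑-*ˡ (allFin v) (𝟙 (⁅ x ⁆ ⊆? pts 𝓕 i)) _)
             (cong (𝟙 (⁅ x ⁆ ⊆? pts 𝓕 i) *_) (block-size i)))) ⟩
    ∑[ i ∈ allFin b ] (𝟙 (⁅ x ⁆ ⊆? pts 𝓕 i) * + 3)
      ≡⟨ trans (∑-*ʳ (allFin b) (+ 3) _) (cong (_* + 3) (sym (degree≡∑ 𝓕 ⁅ x ⁆))) ⟩
    + degree 𝓕 ⁅ x ⁆ * + 3 ∎
    where
    open ≡-Reasoning
    split : ∀ i y → 𝟙 (⁅ x ⁆ ∪ ⁅ y ⁆ ⊆? pts 𝓕 i) ≡ 𝟙 (⁅ x ⁆ ⊆? pts 𝓕 i) * 𝟙 (⁅ y ⁆ ⊆? pts 𝓕 i)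
    split i y = trans
      (𝟙-⇔ (⁅ x ⁆ ∪ ⁅ y ⁆ ⊆? pts 𝓕 i) ((⁅ x ⁆ ⊆? pts 𝓕 i) ×-dec (⁅ y ⁆ ⊆? pts 𝓕 i))
        (λ h → (λ z∈ → h (p⊆p∪q ⁅ y ⁆ z∈)) , λ z∈ → h (q⊆p∪q ⁅ x ⁆ ⁅ y ⁆ z∈))
        (λ (h , h′) z∈ → [ (λ p → h p) , (λ q → h′ q) ]′ (x∈p∪q⁻ ⁅ x ⁆ ⁅ y ⁆ z∈)))
      (𝟙-× (⁅ x ⁆ ⊆? pts 𝓕 i) (⁅ y ⁆ ⊆? pts 𝓕 i))
    block-size : ∀ i → ∑[ y ∈ allFin v ] 𝟙 (⁅ y ⁆ ⊆? pts 𝓕 i) ≡ + 3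
    block-size i = trans (sym (∑-subsets₁ v (λ S → 𝟙 (S ⊆? pts 𝓕 i))))
      (trans (∑-subsets-⊆ v 1 (pts 𝓕 i)) (cong (λ m → + (m C 1)) (proj₂ (block 𝓕 i))))

  -- Each of the r_x blocks through x covers two of the pairs {x, y}.
  rowSum-defect : ∀ x → rowSum defect x ≡ + 2 * + degree 𝓕 ⁅ x ⁆ - l * (+ v - 1ℤ)
  rowSum-defect x = begin
    ∑[ y ∈ allFin v ] (𝟙 (¬? (x ≟ᶠ y)) * t y)
      ≡⟨ ∑-cong (allFin v) (λ y → trans (cong (_* t y) (𝟙-¬ (x ≟ᶠ y))) (distrib (𝟙 (x ≟ᶠ y)) (t y))) ⟩
    ∑[ y ∈ allFin v ] (t y - 𝟙 (x ≟ᶠ y) * t y)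
      ≡⟨ trans (∑-- (allFin v) _ _) (cong₂ _-_ (∑-- (allFin v) _ _)
           (∑-δ _≟ᶠ_ (Unique.allFin⁺ v) (∈-allFin x) t)) ⟩
    ∑[ y ∈ allFin v ] + degree₂ 𝓕 x y - ∑[ y ∈ allFin v ] l - t x
      ≡⟨ cong₂ _-_ (cong₂ _-_ (∑-degree₂ x) (∑-allFin-const v l))
           (cong (λ S → + degree 𝓕 S - l) (∪-idem ⁅ x ⁆)) ⟩
    + degree 𝓕 ⁅ x ⁆ * + 3 - + v * l - (+ degree 𝓕 ⁅ x ⁆ - l)
      ≡⟨ collect (+ degree 𝓕 ⁅ x ⁆) (+ v) l ⟩
    + 2 * + degree 𝓕 ⁅ x ⁆ - l * (+ v - 1ℤ) ∎
    where
    open ≡-Reasoning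
    t : Fin v → ℤ
    t y = + degree₂ 𝓕 x y - l
    distrib : ∀ a b → (1ℤ - a) * b ≡ b - a * b
    distrib = solve-∀
    collect : ∀ r n l → r * + 3 - n * l - (r - l) ≡ + 2 * r - l * (n - 1ℤ)
    collect = solve-∀

  totalDefect squaredDefect : ℤ
  totalDefect   = ∑[ S ∈ subsets v 2 ] (+ degree 𝓕 S - l)
  squaredDefect = ∑[ S ∈ subsets v 2 ] ((+ degree 𝓕 S - l) * (+ degree 𝓕 S - l))

  2*squaredDefect : + 2 * squaredDefect ≡ ∑ (allFin v) (rowSquares defect)
  2*squaredDefect = trans (∑-subsets₂ v _) (∑-cong (allFin v) λ x → ∑-cong (allFin v) λ y →
    idem (¬? (x ≟ᶠ y)) (+ degree₂ 𝓕 x y - l))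
    where
    idem : ∀ {A : Set} (a? : Dec A) t → 𝟙 a? * (t * t) ≡ 𝟙 a? * t * (𝟙 a? * t)
    idem (yes _) = one
      where
      one : ∀ t → 1ℤ * (t * t) ≡ 1ℤ * t * (1ℤ * t)
      one = solve-∀
    idem (no _) t = refl

  2*totalDefect : + 2 * totalDefect ≡ ∑ (allFin v) (rowSum defect)
  2*totalDefect = ∑-subsets₂ v _

  -- Only `v`, `b` and `l` enter, so competing systems have the same total.
  totalDefect≡ : totalDefect ≡ + b * + 3 - l * + (v C 2)
  totalDefect≡ = trans (∑-- (subsets v 2) _ _) (cong₂ _-_ (∑-degree 𝓕 2) (begin
    ∑[ S ∈ subsets v 2 ] l
      -- The trivially true indicator of `S ⊆ ⊤` turns the number of pairs into an instance of
      -- `∑-subsets-⊆`.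
      ≡⟨ ∑-cong (subsets v 2) (λ S → sym (trans (cong (l *_) (𝟙-yes (S ⊆? ⊤) ⊆⊤)) (ℤ.*-identityʳ l))) ⟩
    ∑[ S ∈ subsets v 2 ] (l * 𝟙 (S ⊆? ⊤))
      ≡⟨ ∑-*ˡ (subsets v 2) l _ ⟩
    l * (∑[ S ∈ subsets v 2 ] 𝟙 (S ⊆? ⊤))
      ≡⟨ cong (l *_) (trans (∑-subsets-⊆ v 2 ⊤) (cong (λ m → + (m C 2)) (∣⊤∣≡n v))) ⟩
    l * + (v C 2) ∎))
    where open ≡-Reasoning

  -- The correction depends on `v`, `b` and `l` alone, so squared defects may be compared in place
  -- of squared degrees.
  ∑-degree²≡ : ∑[ S ∈ subsets v 2 ] (+ degree 𝓕 S * + degree 𝓕 S) ≡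
               squaredDefect + (+ 2 * l * (+ b * + 3) - ∑[ S ∈ subsets v 2 ] (l * l))
  ∑-degree²≡ = trans (∑-cong (subsets v 2) λ S → square (+ degree 𝓕 S) l)
    (trans (∑-+ (subsets v 2) _ _) (cong (λ t → squaredDefect + t)
      (trans (∑-- (subsets v 2) _ _) (cong (_- ∑[ S ∈ subsets v 2 ] (l * l))
        (trans (∑-*ˡ (subsets v 2) (+ 2 * l) _) (cong (+ 2 * l *_) (∑-degree 𝓕 2)))))))
    where
    square : ∀ t l → t * t ≡ (t - l) * (t - l) + (+ 2 * l * t - l * l)
    square = solve-∀

  -- Applied to the competitor, this yields the nonzero entry that `even-rows⇒6≤∑squares` starts
  -- from.
  totalDefect≢0⇒entry≢0 : totalDefect ≢ 0ℤ → ∃[ x ] ∃[ y ] defect x y ≢ 0ℤ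
  totalDefect≢0⇒entry≢0 ≢0 with any? (λ x → any? (λ y → ¬? (defect x y ℤ.≟ 0ℤ)))
  ... | yes found = found
  ... | no none = contradiction
    (ℤ.*-cancelˡ-≡ (+ 2) _ _ (trans 2*totalDefect (∑-zero (allFin v) λ x → ∑-zero (allFin v) λ y →
      decidable-stable (defect x y ℤ.≟ 0ℤ) λ h → none (x , y , h)))) ≢0

-- Comparison of two systems with the same parameters

module _ {v b : ℕ} (𝓕 𝓕′ : TS v b) (l : ℤ) where

  totalDefect-≡ : totalDefect 𝓕 l ≡ totalDefect 𝓕′ l
  totalDefect-≡ = trans (totalDefect≡ 𝓕 l) (sym (totalDefect≡ 𝓕′ l))

  -- Both squared defects have the parity of the common total defect.
  coefficient₂-mono : ∀ m → + 2 * squaredDefect 𝓕 l ≤ + 2 + m → m ≤ + 2 * squaredDefect 𝓕′ l →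
                      coefficient 𝓕 2 ≤ coefficient 𝓕′ 2
  coefficient₂-mono m upper lower = coefficient-mono 𝓕 𝓕′ 2
    (subst₂ _≤_ (sym (∑-degree²≡ 𝓕 l)) (sym (∑-degree²≡ 𝓕′ l))
      (ℤ.+-monoˡ-≤ _ (i≤1+j∧2∣i-j⇒i≤j
        (ℤ.*-cancelˡ-≤-pos s (1ℤ + s′) (+ 2) (begin
          + 2 * s              ≤⟨ upper ⟩
          + 2 + m              ≤⟨ ℤ.+-monoʳ-≤ (+ 2) lower ⟩
          + 2 + + 2 * s′       ≡⟨ ℤ.*-distribˡ-+ (+ 2) 1ℤ s′ ⟨
          + 2 * (1ℤ + s′)      ∎))
        (subst (+ 2 ∣_) (trans (cong (λ t → s - t - (s′ - totalDefect 𝓕′ l)) totalDefect-≡)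
                               (cancel s s′ (totalDefect 𝓕′ l)))
          (∣m∣n⇒∣m-n (2∣∑f²-∑f (subsets v 2) (λ S → + degree 𝓕 S - l))
                     (2∣∑f²-∑f (subsets v 2) (λ S → + degree 𝓕′ S - l)))))))
    where
    open ≤-Reasoning
    s = squaredDefect 𝓕 l
    s′ = squaredDefect 𝓕′ l
    cancel : ∀ a b c → a - c - (b - c) ≡ a - b
    cancel = solve-∀

  module _ {c} (rows : ∀ x → rowSum (defect 𝓕 l) x ≡ c ⊎ rowSum (defect 𝓕 l) x ≡ c + + 2) where

    -- By `rowSum-defect` the row sums of both systems at `x` are an even number minus the same
    -- `l * (+ v - 1ℤ)`, and `c` and `c + 2` have the same parity.
    2∣rowSum-c : ∀ x → + 2 ∣ rowSum (defect 𝓕′ l) x - c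
    2∣rowSum-c x = [
      (λ e → divides (r′ - r) (trans
        (cong₂ _-_ (rowSum-defect 𝓕′ l x) (trans (sym e) (rowSum-defect 𝓕 l x)))
        (difference r r′ (l * (+ v - 1ℤ))))) ,
      (λ e → divides (r′ - r + 1ℤ) (trans
        (cong₂ _-_ (rowSum-defect 𝓕′ l x) (sub e (rowSum-defect 𝓕 l x)))
        (difference₂ r r′ (l * (+ v - 1ℤ))))) ]′ (rows x)
      where
      r = + degree 𝓕 ⁅ x ⁆
      r′ = + degree 𝓕′ ⁅ x ⁆
      difference : ∀ r r′ k → + 2 * r′ - k - (+ 2 * r - k) ≡ (r′ - r) * + 2
      difference = solve-∀
      difference₂ : ∀ r r′ k → + 2 * r′ - k - (+ 2 * r - k - + 2) ≡ (r′ - r + 1ℤ) * + 2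
      difference₂ = solve-∀
      sub : ∀ {s t} → s ≡ c + + 2 → s ≡ t → c ≡ t - + 2
      sub refl refl = shift c
        where
        shift : ∀ c → c ≡ c + + 2 - + 2
        shift = solve-∀

    -- Solving `rowSum-defect` for the point degree turns the row sums `c` and `c + 2` into two
    -- consecutive degrees `a` and `a + 1`, so `∑-square-min` applies.
    coefficient₁-mono : coefficient 𝓕 1 ≤ coefficient 𝓕′ 1
    coefficient₁-mono = coefficient-mono 𝓕 𝓕′ 1 (∑-square-min (subsets v 1) _ _ a
      (λ S S∈ → values (#≡1⇒singleton S (∈-subsets⇒# v 1 S∈)))
      (trans (∑-degree 𝓕 1) (sym (∑-degree 𝓕′ 1))))
      where
      k = l * (+ v - 1ℤ)
      x₀ : Fin v
      x₀ = fromℕ< (ℕ.≤-trans (s≤s z≤n) (v≥3 𝓕))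
      -- That `c + k` is even is read off at the point `x₀`: half of it is the degree of `x₀`, or
      -- one less if the row sum there is `c + 2`.
      base : ∃[ a ] + 2 * a - k ≡ c
      base = [ (λ e → + degree 𝓕 ⁅ x₀ ⁆ , trans (sym (rowSum-defect 𝓕 l x₀)) e)
             , (λ e → + degree 𝓕 ⁅ x₀ ⁆ - 1ℤ
                    , lower (+ degree 𝓕 ⁅ x₀ ⁆) k c (trans (sym (rowSum-defect 𝓕 l x₀)) e))
             ]′ (rows x₀)
        where
        lower : ∀ r k c → + 2 * r - k ≡ c + + 2 → + 2 * (r - 1ℤ) - k ≡ c
        lower r k c e = trans (left r k) (trans (cong (_- + 2) e) (right c))
          where
          left : ∀ r k → + 2 * (r - 1ℤ) - k ≡ + 2 * r - k - + 2
          left = solve-∀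
          right : ∀ c → c + + 2 - + 2 ≡ c
          right = solve-∀
      a = proj₁ base
      cancel : ∀ r s → + 2 * r - k ≡ + 2 * s - k → r ≡ s
      cancel r s = ℤ.*-cancelˡ-≡ (+ 2) r s ∘ ∙-cancelʳ (- k) (+ 2 * r) (+ 2 * s)
      raise : ∀ a k → + 2 * a - k + + 2 ≡ + 2 * (a + 1ℤ) - k
      raise = solve-∀
      values : ∀ {S} → ∃[ x ] S ≡ ⁅ x ⁆ → + degree 𝓕 S ≡ a ⊎ + degree 𝓕 S ≡ a + 1ℤ
      values (x , refl) = ⊎-map
        (λ e → cancel (+ degree 𝓕 ⁅ x ⁆) a (trans (sym (rowSum-defect 𝓕 l x)) (trans e (sym (proj₂ base)))))
        (λ e → cancel (+ degree 𝓕 ⁅ x ⁆) (a + 1ℤ) (trans (sym (rowSum-defect 𝓕 l x))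
          (trans e (trans (cong (_+ + 2) (sym (proj₂ base))) (raise a k)))))
        (rows x)

    odd⇒coefficient₂-mono : ¬ (+ 2 ∣ c) → ∑ (allFin v) (rowSquares (defect 𝓕 l)) ≤ + 2 + + v →
                            coefficient 𝓕 2 ≤ coefficient 𝓕′ 2
    odd⇒coefficient₂-mono c-odd upper = coefficient₂-mono (+ v)
      (subst (_≤ + 2 + + v) (sym (2*squaredDefect 𝓕 l)) upper)
      (subst (+ v ≤_) (sym (2*squaredDefect 𝓕′ l)) (odd-rows⇒n≤∑squares (defect 𝓕′ l) λ x 2∣row →
        c-odd (subst (+ 2 ∣_) (cancel (rowSum (defect 𝓕′ l) x) c) (∣m∣n⇒∣m-n 2∣row (2∣rowSum-c x)))))
      where
      cancel : ∀ a b → a - (a - b) ≡ b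
      cancel = solve-∀

    even⇒coefficient₂-mono : + 2 ∣ c → totalDefect 𝓕 l ≢ 0ℤ →
                             ∑ (allFin v) (rowSquares (defect 𝓕 l)) ≤ + 8 →
                             coefficient 𝓕 2 ≤ coefficient 𝓕′ 2
    even⇒coefficient₂-mono c-even total≢0 upper
      with totalDefect≢0⇒entry≢0 𝓕′ l (total≢0 ∘ trans totalDefect-≡)
    ... | x , y , entry≢0 = coefficient₂-mono (+ 6)
      (subst (_≤ + 8) (sym (2*squaredDefect 𝓕 l)) upper)
      (subst (+ 6 ≤_) (sym (2*squaredDefect 𝓕′ l))
        (even-rows⇒6≤∑squares (defect 𝓕′ l) (defect-sym 𝓕′ l) (defect-diag 𝓕′ l)
          (λ x → subst (+ 2 ∣_) (cancel (rowSum (defect 𝓕′ l) x) c) (∣m∣n⇒∣m+n (2∣rowSum-c x) c-even))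
          {x} {y} entry≢0))
      where
      cancel : ∀ a b → a - b + b ≡ a
      cancel = solve-∀

-- Signed graphs with their label sums

record FiniteGraph (G : SignedGraph) : Set where
  field
    vertices : List (Vertex G)
    unique   : Unique vertices
    complete : ∀ x → x ∈ vertices
    edge?    : ∀ s x y → Dec (Edge G s x y)

  label : Vertex G → Vertex G → ℤ
  label x y = 𝟙 (edge? ⊞ x y) - 𝟙 (edge? ⊟ x y)

  labelSum labelSquares : Vertex G → ℤ
  labelSum     x = ∑[ y ∈ vertices ] label x y
  labelSquares x = ∑[ y ∈ vertices ] (label x y * label x y)

-- These are the invariants needed for the comparison. For the graphs below `t` is twice the number
-- of edges, since each edge is seen from both ends.
record Profile (G : SignedGraph) (c t : ℤ) : Set where
  field
    finite : FiniteGraph G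
  open FiniteGraph finite public
  field
    labelSum-values : ∀ x → labelSum x ≡ c ⊎ labelSum x ≡ c + + 2
    ∑-labelSquares  : ∑ vertices labelSquares ≡ t

∑-⊎ : ∀ {A B : Set} (xs : List A) (ys : List B) (f : A ⊎ B → ℤ) →
      ∑ (map inj₁ xs ++ map inj₂ ys) f ≡ ∑[ x ∈ xs ] f (inj₁ x) + ∑[ y ∈ ys ] f (inj₂ y)
∑-⊎ xs ys f = trans (∑-++ (map inj₁ xs) _ f) (cong₂ _+_ (∑-map inj₁ xs f) (∑-map inj₂ ys f))

-- No edge joins the summands, so labels between them are 0 and every label sum is one taken inside
-- a summand.
⊕-profile : ∀ {G H c s t} → Profile G c s → Profile H c t → Profile (G ⊕ H) c (s + t)
⊕-profile {G} {H} {c} {s} {t} π ρ = record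
  { finite = record
    { vertices = map inj₁ G.vertices ++ map inj₂ H.vertices
    ; unique   = Unique.++⁺ (Unique.map⁺ inj₁-injective G.unique)
                            (Unique.map⁺ inj₂-injective H.unique) disjoint
    ; complete = λ
      { (inj₁ x) → ∈-++⁺ˡ (∈-map⁺ inj₁ (G.complete x))
      ; (inj₂ y) → ∈-++⁺ʳ (map inj₁ G.vertices) (∈-map⁺ inj₂ (H.complete y))
      }
    ; edge?    = edge?
    }
  ; labelSum-values = λ
    { (inj₁ x) → subst (λ u → u ≡ c ⊎ u ≡ c + + 2) (sym (∑-inj₁ (λ u → u) refl x)) (G.labelSum-values x)
    ; (inj₂ y) → subst (λ u → u ≡ c ⊎ u ≡ c + + 2) (sym (∑-inj₂ (λ u → u) refl y)) (H.labelSum-values y)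
    }
  ; ∑-labelSquares = trans (∑-⊎ G.vertices H.vertices _) (cong₂ _+_
      (trans (∑-cong G.vertices (∑-inj₁ (λ u → u * u) refl)) G.∑-labelSquares)
      (trans (∑-cong H.vertices (∑-inj₂ (λ u → u * u) refl)) H.∑-labelSquares))
  }
  where
  module G = Profile π
  module H = Profile ρ
  disjoint : ∀ {z} → ¬ (z ∈ map inj₁ G.vertices × z ∈ map inj₂ H.vertices)
  disjoint (p , q) with ∈-map⁻ inj₁ p | ∈-map⁻ inj₂ q
  ... | _ , _ , refl | _ , _ , ()
  edge? : ∀ s x y → Dec (Edge (G ⊕ H) s x y)
  edge? s (inj₁ x) (inj₁ y) = G.edge? s x y
  edge? s (inj₂ x) (inj₂ y) = H.edge? s x y
  edge? s (inj₁ _) (inj₂ _) = no λ ()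
  edge? s (inj₂ _) (inj₁ _) = no λ ()
  label : Vertex (G ⊕ H) → Vertex (G ⊕ H) → ℤ
  label x y = 𝟙 (edge? ⊞ x y) - 𝟙 (edge? ⊟ x y)
  vs = map inj₁ G.vertices ++ map inj₂ H.vertices
  -- The function `g` is the identity for label sums and squaring for label squares.
  ∑-inj₁ : ∀ (g : ℤ → ℤ) → g 0ℤ ≡ 0ℤ → ∀ x →
           ∑[ y ∈ vs ] g (label (inj₁ x) y) ≡ ∑[ y ∈ G.vertices ] g (G.label x y)
  ∑-inj₁ g g0 x = trans (∑-⊎ G.vertices H.vertices _) (trans
    (cong (λ u → ∑[ y ∈ G.vertices ] g (G.label x y) + u) (∑-zero H.vertices λ _ → g0)) (ℤ.+-identityʳ _))
  ∑-inj₂ : ∀ (g : ℤ → ℤ) → g 0ℤ ≡ 0ℤ → ∀ x →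
           ∑[ y ∈ vs ] g (label (inj₂ x) y) ≡ ∑[ y ∈ H.vertices ] g (H.label x y)
  ∑-inj₂ g g0 x = trans (∑-⊎ G.vertices H.vertices _) (trans
    (cong (λ u → u + ∑[ y ∈ H.vertices ] g (H.label x y)) (∑-zero G.vertices λ _ → g0)) (ℤ.+-identityˡ _))

-- A label is the label in `G` times the indicator of lying in the same copy (`factor`), so a row
-- sees its own copy only.
⊗-profile : ∀ n {G c t} → Profile G c t → Profile (n ⊗ G) c (+ n * t)
⊗-profile n {G} {c} {t} π = record
  { finite = record
    { vertices = vs
    ; unique   = Unique.cartesianProduct⁺ (Unique.allFin⁺ n) G.unique
    ; complete = λ (i , x) → ∈-cartesianProduct⁺ (∈-allFin i) (G.complete x)
    ; edge?    = edge?
    }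
  ; labelSum-values = λ (i , x) → subst (λ u → u ≡ c ⊎ u ≡ c + + 2)
      (sym (trans (∑-cong vs λ (j , y) → factor i j x y) (∑-copy (G.label x) i))) (G.labelSum-values x)
  ; ∑-labelSquares = begin
      ∑[ (i , x) ∈ vs ] (∑[ (j , y) ∈ vs ] (label (i , x) (j , y) * label (i , x) (j , y)))
        ≡⟨ ∑-cong vs (λ (i , x) → trans (∑-cong vs λ (j , y) →
             trans (cong (λ u → u * u) (factor i j x y)) (square (i ≟ᶠ j) (G.label x y)))
             (∑-copy (λ y → G.label x y * G.label x y) i)) ⟩
      ∑[ (i , x) ∈ vs ] G.labelSquares x
        ≡⟨ trans (∑-cartesianProduct (allFin n) G.vertices _) (∑-cong (allFin n) λ _ → G.∑-labelSquares) ⟩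
      ∑[ i ∈ allFin n ] t
        ≡⟨ ∑-allFin-const n t ⟩
      + n * t ∎
  }
  where
  open ≡-Reasoning
  module G = Profile π
  vs = cartesianProduct (allFin n) G.vertices
  edge? : ∀ s x y → Dec (Edge (n ⊗ G) s x y)
  edge? s (i , x) (j , y) = (i ≟ᶠ j) ×-dec G.edge? s x y
  label : Vertex (n ⊗ G) → Vertex (n ⊗ G) → ℤ
  label x y = 𝟙 (edge? ⊞ x y) - 𝟙 (edge? ⊟ x y)
  factor : ∀ i j x y → label (i , x) (j , y) ≡ 𝟙 (i ≟ᶠ j) * G.label x y
  factor i j x y = trans
    (cong₂ _-_ (𝟙-× (i ≟ᶠ j) (G.edge? ⊞ x y)) (𝟙-× (i ≟ᶠ j) (G.edge? ⊟ x y)))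
    (distrib (𝟙 (i ≟ᶠ j)) (𝟙 (G.edge? ⊞ x y)) (𝟙 (G.edge? ⊟ x y)))
    where
    distrib : ∀ a b c → a * b - a * c ≡ a * (b - c)
    distrib = solve-∀
  square : ∀ {A : Set} (a? : Dec A) u → 𝟙 a? * u * (𝟙 a? * u) ≡ 𝟙 a? * (u * u)
  square (yes _) = one
    where
    one : ∀ u → 1ℤ * u * (1ℤ * u) ≡ 1ℤ * (u * u)
    one = solve-∀
  square (no _) u = refl
  ∑-copy : ∀ (f : Vertex G → ℤ) i → ∑[ (j , y) ∈ vs ] (𝟙 (i ≟ᶠ j) * f y) ≡ ∑ G.vertices f
  ∑-copy f i = trans (∑-cartesianProduct (allFin n) G.vertices _)
    (trans (∑-cong (allFin n) λ j → ∑-*ˡ G.vertices (𝟙 (i ≟ᶠ j)) f)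
           (∑-δ _≟ᶠ_ (Unique.allFin⁺ n) (∈-allFin i) (λ _ → ∑ G.vertices f)))

fromEdges-finite : ∀ n es → FiniteGraph (fromEdges n es)
fromEdges-finite n es = record
  { vertices = allFin n
  ; unique   = Unique.allFin⁺ n
  ; complete = ∈-allFin
  ; edge?    = λ s x y → ((s , x , y) ∈? es) ⊎-dec ((s , y , x) ∈? es)
  }
  where open DecMembership (×-≡-dec _≟ˢ_ (×-≡-dec _≟ᶠ_ _≟ᶠ_)) using (_∈?_)

isolated-profile : ∀ n {c} → 0ℤ ≡ c ⊎ 0ℤ ≡ c + + 2 → Profile (isolated n) c 0ℤ
isolated-profile n {c} 0∈ = record
  { finite = fromEdges-finite n []
  ; labelSum-values = λ x → subst (λ u → u ≡ c ⊎ u ≡ c + + 2) (sym (∑-0 (allFin n))) 0∈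
  ; ∑-labelSquares = ∑-zero (allFin n) λ _ → ∑-0 (allFin n)
  }

labelSum-values? : ∀ n es c → let open FiniteGraph (fromEdges-finite n es) in
                   Dec (∀ x → labelSum x ≡ c ⊎ labelSum x ≡ c + + 2)
labelSum-values? n es c = all? λ x → (labelSum x ℤ.≟ c) ⊎-dec (labelSum x ℤ.≟ c + + 2)
  where open FiniteGraph (fromEdges-finite n es)

module _ {v : ℕ} {H : SignedGraph} {c t : ℤ} (bijection : Fin v ↔ Vertex H) (π : Profile H c t) where

  open Profile π

  private
    φ : Fin v → Vertex H
    φ = Inverse.to bijection
    φ⁻¹ = Inverse.from bijection

    -- Both lists enumerate all vertices of `H` without repetition. This carries sums over the
    -- points to sums over the model graph.
    map-φ↭vertices : map φ (allFin v) ↭ vertices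
    map-φ↭vertices = ∼bag⇒↭ (unique∧set⇒bag
      (Unique.map⁺ {f = φ} injective (Unique.allFin⁺ v))
      unique
      (mk⇔ (λ _ → complete _)
           (λ _ → onto _)))
      where
      injective : ∀ {x y} → φ x ≡ φ y → x ≡ y
      injective {x} {y} e = trans (sym (Inverse.strictlyInverseʳ bijection x))
        (trans (cong φ⁻¹ e) (Inverse.strictlyInverseʳ bijection y))
      onto : ∀ u → u ∈ map φ (allFin v)
      onto u = subst (_∈ map φ (allFin v)) (Inverse.strictlyInverseˡ bijection u)
        (∈-map⁺ φ (∈-allFin (φ⁻¹ u)))

    ∑-φ : ∀ (f : Vertex H → ℤ) → ∑[ x ∈ allFin v ] f (φ x) ≡ ∑ vertices f
    ∑-φ f = trans (sym (∑-map φ (allFin v) f)) (∑-↭ f map-φ↭vertices)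

  module _ (d : Fin v → Fin v → ℤ) (d≡label : ∀ x y → d x y ≡ label (φ x) (φ y)) where

    rowSum-values : ∀ x → rowSum d x ≡ c ⊎ rowSum d x ≡ c + + 2
    rowSum-values x = subst (λ u → u ≡ c ⊎ u ≡ c + + 2)
      (sym (trans (∑-cong (allFin v) (d≡label x)) (∑-φ (label (φ x))))) (labelSum-values (φ x))

    ∑-rowSquares : ∑ (allFin v) (rowSquares d) ≡ t
    ∑-rowSquares = trans (∑-cong (allFin v) λ x → trans
      (∑-cong (allFin v) λ y → cong (λ u → u * u) (d≡label x y)) (∑-φ (λ u → label (φ x) u * label (φ x) u)))
      (trans (∑-φ labelSquares) ∑-labelSquares)

-- Nearly 2-balanced systems

-- Cancelling `l` leaves three closed cases. The form `l + -1ℤ` agrees by computation with the edge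
-- condition `l + (s ◃ 1)` of `defectGraph`.
𝟙-near : ∀ a l → a ≡ l - 1ℤ ⊎ a ≡ l ⊎ a ≡ l + 1ℤ → a - l ≡ 𝟙 (a ℤ.≟ l + 1ℤ) - 𝟙 (a ℤ.≟ l + -1ℤ)
𝟙-near a l = λ
  { (inj₁ a≡l-1)        → offset -1ℤ refl a≡l-1
  ; (inj₂ (inj₁ a≡l))   → offset 0ℤ refl (trans a≡l (sym (ℤ.+-identityʳ l)))
  ; (inj₂ (inj₂ a≡l+1)) → offset 1ℤ refl a≡l+1
  }
  where
  cancel : ∀ l j → l + j - l ≡ j
  cancel = solve-∀
  offset : ∀ j → j ≡ 𝟙 (j ℤ.≟ 1ℤ) - 𝟙 (j ℤ.≟ -1ℤ) → a ≡ l + j →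
           a - l ≡ 𝟙 (a ℤ.≟ l + 1ℤ) - 𝟙 (a ℤ.≟ l + -1ℤ)
  offset j j≡ refl = trans (cancel l j) (trans j≡ (cong₂ _-_ (shift 1ℤ) (shift -1ℤ)))
    where
    shift : ∀ k → 𝟙 (j ℤ.≟ k) ≡ 𝟙 (l + j ℤ.≟ l + k)
    shift k = 𝟙-⇔ (j ℤ.≟ k) (l + j ℤ.≟ l + k) (cong (λ i → l + i)) (∙-cancelˡ l j k)

module _ {v b : ℕ} {𝓕 : TS v b} (N : NearlyTwoBalanced 𝓕) where

  open NearlyTwoBalanced N

  -- By `near` a defect is the signed indicator of an edge of `D`, whose clause `x ≢ y` is the
  -- factor clearing the diagonal; the isomorphism then carries edges to edges with their signs.
  defect≡label : ∀ {H} (D≅H : D ≅ H) (H-finite : FiniteGraph H) → let φ = Inverse.to (_≅_.bijection D≅H) in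
                 ∀ x y → defect 𝓕 l x y ≡ FiniteGraph.label H-finite (φ x) (φ y)
  defect≡label D≅H H-finite x y = begin
    𝟙 x≢?y * (a - l)
      ≡⟨ by-near ⟩
    𝟙 x≢?y * (𝟙 (a ℤ.≟ l + 1ℤ) - 𝟙 (a ℤ.≟ l + -1ℤ))
      ≡⟨ distrib (𝟙 x≢?y) (𝟙 (a ℤ.≟ l + 1ℤ)) (𝟙 (a ℤ.≟ l + -1ℤ)) ⟩
    𝟙 x≢?y * 𝟙 (a ℤ.≟ l + 1ℤ) - 𝟙 x≢?y * 𝟙 (a ℤ.≟ l + -1ℤ)
      ≡⟨ cong₂ _-_ (edge ⊞) (edge ⊟) ⟩
    𝟙 (edge? ⊞ (φ x) (φ y)) - 𝟙 (edge? ⊟ (φ x) (φ y)) ∎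
    where
    open ≡-Reasoning
    open FiniteGraph H-finite
    open _≅_ D≅H
    φ = Inverse.to bijection
    a = + degree₂ 𝓕 x y
    x≢?y = ¬? (x ≟ᶠ y)
    by-near : 𝟙 x≢?y * (a - l) ≡ 𝟙 x≢?y * (𝟙 (a ℤ.≟ l + 1ℤ) - 𝟙 (a ℤ.≟ l + -1ℤ))
    by-near with x ≟ᶠ y
    ... | yes _  = refl
    ... | no x≢y = cong (1ℤ *_) (𝟙-near a l (near x y x≢y))
    distrib : ∀ a b c → a * (b - c) ≡ a * b - a * c
    distrib = solve-∀
    edge : ∀ s → 𝟙 x≢?y * 𝟙 (a ℤ.≟ l + (s ◃ 1)) ≡ 𝟙 (edge? s (φ x) (φ y))
    edge s = trans (sym (𝟙-× x≢?y (a ℤ.≟ l + (s ◃ 1))))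
      (𝟙-⇔ (x≢?y ×-dec (a ℤ.≟ l + (s ◃ 1))) (edge? s (φ x) (φ y))
        (Equivalence.to (preserves s x y)) (Equivalence.from (preserves s x y)))

  totalDefect≡ε : totalDefect 𝓕 l ≡ ε
  totalDefect≡ε = trans (totalDefect≡ 𝓕 l) (trans
    (cong (_- l * + (v C 2)) (trans (ℤ.*-comm (+ b) (+ 3)) (trans (sym (ℤ.pos-* 3 b)) (proj₁ associated))))
    (cancel (l * + (v C 2)) ε))
    where
    cancel : ∀ a b → a + b - a ≡ b
    cancel = solve-∀

  module _ (𝓕′ : TS v b) {H : SignedGraph} {c t : ℤ} (π : Profile H c t) (D≅H : D ≅ H) where

    private
      rows : ∀ x → rowSum (defect 𝓕 l) x ≡ c ⊎ rowSum (defect 𝓕 l) x ≡ c + + 2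
      rows = rowSum-values (_≅_.bijection D≅H) π (defect 𝓕 l) (defect≡label D≅H (Profile.finite π))
      squares : ∑ (allFin v) (rowSquares (defect 𝓕 l)) ≡ t
      squares = ∑-rowSquares (_≅_.bijection D≅H) π (defect 𝓕 l) (defect≡label D≅H (Profile.finite π))

    even-profile : + 2 ∣ c → ε ≢ 0ℤ → t ≤ + 8 →
                   coefficient 𝓕 1 ≤ coefficient 𝓕′ 1 × coefficient 𝓕 2 ≤ coefficient 𝓕′ 2
    even-profile 2∣c ε≢0 t≤8 = coefficient₁-mono 𝓕 𝓕′ l rows
      , even⇒coefficient₂-mono 𝓕 𝓕′ l rows 2∣c (ε≢0 ∘ trans (sym totalDefect≡ε))
          (subst (_≤ + 8) (sym squares) t≤8)

    odd-profile : ¬ (+ 2 ∣ c) → t ≤ + 2 + + v →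
                  coefficient 𝓕 1 ≤ coefficient 𝓕′ 1 × coefficient 𝓕 2 ≤ coefficient 𝓕′ 2
    odd-profile 2∤c t≤2+v = coefficient₁-mono 𝓕 𝓕′ l rows
      , odd⇒coefficient₂-mono 𝓕 𝓕′ l rows 2∤c (subst (_≤ + 2 + + v) (sym squares) t≤2+v)

-- Profiles of the possible defect graphs

fromEdges-profile : ∀ {n es c t} {_ : True (labelSum-values? n es c)} →
  (let open FiniteGraph (fromEdges-finite n es)) → ∑ vertices labelSquares ≡ t → Profile (fromEdges n es) c t
fromEdges-profile {n} {es} {c} {_} {values} squares = record
  { finite = fromEdges-finite n es
  ; labelSum-values = toWitness {a? = labelSum-values? n es c} values
  ; ∑-labelSquares = squares
  }

-- For positive ε the signed degrees are 0 and 2, for negative ε they are -2 and 0. Both ranges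
-- contain 0, as the added isolated vertices require.
G₁-profile : Profile G₁ 0ℤ (+ 6)
G₁-profile = fromEdges-profile refl

G₋₁-profile : Profile G₋₁ (- + 2) (+ 6)
G₋₁-profile = fromEdges-profile refl

G₂-profile : Profile G₂ 0ℤ (+ 8)
G₂-profile = fromEdges-profile refl

G₋₂-profile : Profile G₋₂ (- + 2) (+ 8)
G₋₂-profile = fromEdges-profile refl

-- The signed degrees are 1 or -1 according to `s`. The common `c = -1ℤ` lets edges of both signs
-- and stars be combined by `⊕-profile`.
K₂-profile : ∀ s → Profile (K₂ s) -1ℤ (+ 2)
K₂-profile ⊞ = fromEdges-profile refl
K₂-profile ⊟ = fromEdges-profile refl

K₁,₃-⊞⊞⊟-profile : Profile (K₁,₃ ⊞ ⊞ ⊟) -1ℤ (+ 6)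
K₁,₃-⊞⊞⊟-profile = fromEdges-profile refl

K₁,₃-⊞⊟⊟-profile : Profile (K₁,₃ ⊞ ⊟ ⊟) -1ℤ (+ 6)
K₁,₃-⊞⊟⊟-profile = fromEdges-profile refl

matching-profile : ∀ p q → Profile (matching p q) -1ℤ (+ p * + 2 + + q * + 2)
matching-profile p q = ⊕-profile (⊗-profile p (K₂-profile ⊞)) (⊗-profile q (K₂-profile ⊟))

module _ {v b : ℕ} (𝓕 𝓕′ : TS v b) (N : NearlyTwoBalanced 𝓕) where

  open NearlyTwoBalanced N

  private
    Better : Set
    Better = coefficient 𝓕 1 ≤ coefficient 𝓕′ 1 × coefficient 𝓕 2 ≤ coefficient 𝓕′ 2

  IsoG⇒coefficients-mono : IsoG v ε D → Better
  IsoG⇒coefficients-mono =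
    [ via G₁-profile (inj₁ refl) , [ via G₋₁-profile (inj₂ refl) ,
    [ via G₂-profile (inj₁ refl) , via G₋₂-profile (inj₂ refl) ]′ ]′ ]′
    where
    -- The conditions on parity, on `e` and on the size are closed and settled by evaluation;
    -- `t + 0ℤ` includes the isolated vertices.
    via : ∀ {H c t e k} → Profile H c t → 0ℤ ≡ c ⊎ 0ℤ ≡ c + + 2 →
          {True (+ 2 ∣? c)} → {False (e ℤ.≟ 0ℤ)} → {True (t + 0ℤ ℤ.≤? + 8)} →
          ε ≡ e × D ≅ H ⊕ isolated k → Better
    via {k = k} π 0∈ {2∣c} {e≢0} {t≤8} (refl , iso) = even-profile N 𝓕′
      (⊕-profile π (isolated-profile k 0∈)) iso (toWitness 2∣c) (toWitnessFalse e≢0) (toWitness t≤8)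

  private
    -- Here `k` is the number of matched vertices. Adding the two equations makes ε cancel in every
    -- use.
    matching-size : ∀ p q {m n} k → + (4 ℕ.* p) ≡ m → + (4 ℕ.* q) ≡ n → m + n ≡ + 2 * k →
                    + p * + 2 + + q * + 2 ≡ k
    matching-size p q k refl refl 4p+4q≡2k = ℤ.*-cancelˡ-≡ (+ 2) _ k (begin
      + 2 * (+ p * + 2 + + q * + 2)   ≡⟨ quadruple (+ p) (+ q) ⟩
      + 4 * + p + + 4 * + q           ≡⟨ cong₂ _+_ (ℤ.pos-* 4 p) (ℤ.pos-* 4 q) ⟨
      + (4 ℕ.* p) + + (4 ℕ.* q)       ≡⟨ 4p+4q≡2k ⟩
      + 2 * k                         ∎)
      where
      open ≡-Reasoning
      quadruple : ∀ p q → + 2 * (p * + 2 + q * + 2) ≡ + 4 * p + + 4 * q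
      quadruple = solve-∀

    2∤-1 : ¬ (+ 2 ∣ -1ℤ)
    2∤-1 = from-no (+ 2 ∣? -1ℤ)

  IsoH⁰⇒coefficients-mono : IsoH⁰ v ε D → Better
  IsoH⁰⇒coefficients-mono (p , q , 4p , 4q , iso) = odd-profile N 𝓕′ (matching-profile p q) iso 2∤-1
    (subst (_≤ + 2 + + v) (sym (matching-size p q (+ v) 4p 4q (collect (+ v) ε)))
      (ℤ.i≤j⇒i≤k+j (+ 2) ℤ.≤-refl))
    where
    collect : ∀ v ε → v + + 2 * ε + (v - + 2 * ε) ≡ + 2 * v
    collect = solve-∀

  private
    star⊕matching : ∀ {K} → Profile K -1ℤ (+ 6) → ∀ p q {m n} →
      + (4 ℕ.* p) ≡ m → + (4 ℕ.* q) ≡ n → m + n ≡ + 2 * (+ v - + 4) → D ≅ K ⊕ matching p q → Better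
    star⊕matching π p q 4p 4q 4p+4q iso = odd-profile N 𝓕′ (⊕-profile π (matching-profile p q)) iso 2∤-1
      -- The star gives 6 and the matching `v - 4`: the bound `2 + v` is attained.
      (ℤ.≤-reflexive (trans
        (cong (λ i → + 6 + i) (matching-size p q (+ v - + 4) 4p 4q 4p+4q)) (collect (+ v))))
      where
      collect : ∀ v → + 6 + (v - + 4) ≡ + 2 + v
      collect = solve-∀

  IsoH¹⇒coefficients-mono : IsoH¹ v ε D → Better
  IsoH¹⇒coefficients-mono (p , q , 4p , 4q , iso) =
    star⊕matching K₁,₃-⊞⊞⊟-profile p q 4p 4q (collect (+ v) ε) iso
    where
    collect : ∀ v ε → v - + 6 + + 2 * ε + (v - + 2 - + 2 * ε) ≡ + 2 * (v - + 4)
    collect = solve-∀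

  IsoH²⇒coefficients-mono : IsoH² v ε D → Better
  IsoH²⇒coefficients-mono (p , q , 4p , 4q , iso) =
    star⊕matching K₁,₃-⊞⊟⊟-profile p q 4p 4q (collect (+ v) ε) iso
    where
    collect : ∀ v ε → v - + 2 + + 2 * ε + (v - + 6 - + 2 * ε) ≡ + 2 * (v - + 4)
    collect = solve-∀

  nearlyTwoBalanced⇒coefficients-mono : C1 v b ⊎ C2 v b → Better
  nearlyTwoBalanced⇒coefficients-mono (inj₁ c1) = IsoG⇒coefficients-mono (underC1 c1)
  nearlyTwoBalanced⇒coefficients-mono (inj₂ c2) with + 2 ∣? ε - + (v ℕ./ 2)
  ... | yes ε≡v/2 = IsoH⁰⇒coefficients-mono (proj₁ (underC2 c2) (∣⇒∣ᵤ ε≡v/2))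
  ... | no  ε≢v/2 = [ IsoH¹⇒coefficients-mono , IsoH²⇒coefficients-mono ]′ (proj₂ (underC2 c2) (ε≢v/2 ∘ ∣ᵤ⇒∣))

-- Rational cubics near the half-line y ≥ 0

toℚᵘ-/1 : ∀ i → ℚ.toℚᵘ (i / 1) ℚᵘ.≃ mkℚᵘ i 0
toℚᵘ-/1 i = ℚ.toℚᵘ-fromℚᵘ (mkℚᵘ i 0)

-- As `_/_` normalises, the identity is checked on unnormalised fractions with denominator 1.
/1-+ : ∀ i j → (i ℤ.+ j) / 1 ≡ i / 1 ℚ.+ j / 1
/1-+ i j = ℚ.toℚᵘ-injective (begin
  ℚ.toℚᵘ ((i ℤ.+ j) / 1)
    ≈⟨ toℚᵘ-/1 (i ℤ.+ j) ⟩
  mkℚᵘ (i ℤ.+ j) 0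
    ≈⟨ *≡* (cong (ℤ._* + 1) (cong₂ ℤ._+_ (sym (ℤ.*-identityʳ i)) (sym (ℤ.*-identityʳ j)))) ⟩
  mkℚᵘ i 0 ℚᵘ.+ mkℚᵘ j 0
    ≈⟨ ℚᵘ.+-cong (toℚᵘ-/1 i) (toℚᵘ-/1 j) ⟨
  ℚ.toℚᵘ (i / 1) ℚᵘ.+ ℚ.toℚᵘ (j / 1)
    ≈⟨ ℚ.toℚᵘ-homo-+ (i / 1) (j / 1) ⟨
  ℚ.toℚᵘ (i / 1 ℚ.+ j / 1) ∎)
  where open ℚᵘ.≃-Reasoning

/1-mono : ∀ {i j} → i ℤ.≤ j → i / 1 ℚ.≤ j / 1
/1-mono {i} {j} i≤j = ℚ.toℚᵘ-cancel-≤ (ℚᵘ.≤-respˡ-≃ (ℚᵘ.≃-sym (toℚᵘ-/1 i))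
  (ℚᵘ.≤-respʳ-≃ (ℚᵘ.≃-sym (toℚᵘ-/1 j)) (*≤* (ℤ.*-monoʳ-≤-nonNeg (+ 1) i≤j))))

0≤q-p⇒p≤q : ∀ {p q} → 0ℚ ℚ.≤ q ℚ.- p → p ℚ.≤ q
0≤q-p⇒p≤q {p} {q} h = subst₂ ℚ._≤_ (ℚ.+-identityˡ p)
  (solve 2 (λ p q → (q :- p) :+ p := q) refl p q) (ℚ.+-monoˡ-≤ p h)

p≤q⇒0≤q-p : ∀ {p q} → p ℚ.≤ q → 0ℚ ℚ.≤ q ℚ.- p
p≤q⇒0≤q-p {p} {q} h = subst (ℚ._≤ q ℚ.- p) (ℚ.+-inverseʳ p) (ℚ.+-monoˡ-≤ (ℚ.- p) h)

0≤+ : ∀ {p q} → 0ℚ ℚ.≤ p → 0ℚ ℚ.≤ q → 0ℚ ℚ.≤ p ℚ.+ q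
0≤+ 0≤p 0≤q = ℚ.+-mono-≤ 0≤p 0≤q

0≤* : ∀ {p q} → 0ℚ ℚ.≤ p → 0ℚ ℚ.≤ q → 0ℚ ℚ.≤ p ℚ.* q
0≤* {p} {q} 0≤p 0≤q = ℚ.nonNegative⁻¹ (p ℚ.* q)
  {{ℚ.nonNeg*nonNeg⇒nonNeg p {{ℚ.nonNegative 0≤p}} q {{ℚ.nonNegative 0≤q}}}}

0≤p*p : ∀ p → 0ℚ ℚ.≤ p ℚ.* p
0≤p*p p = [ (λ h → 0≤* h h) , (λ h → subst (0ℚ ℚ.≤_) (solve 1 (λ p → (:- p) :* (:- p) := p :* p) refl p)
  (0≤* (ℚ.neg-antimono-≤ h) (ℚ.neg-antimono-≤ h))) ]′ (ℚ.≤-total 0ℚ p)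

-- If `y` is negative, then it lies between -1 and 0, where the cube is no smaller than `y` itself.
0≤y³+η : ∀ {y η} → 0ℚ ℚ.≤ η → η ℚ.≤ 1ℚ → 0ℚ ℚ.≤ y ℚ.+ η → 0ℚ ℚ.≤ y ℚ.* y ℚ.* y ℚ.+ η
0≤y³+η {y} {η} 0≤η η≤1 0≤y+η = [ (λ 0≤y → 0≤+ (0≤* (0≤* 0≤y 0≤y) 0≤y) 0≤η) , negative ]′ (ℚ.≤-total 0ℚ y)
  where
  negative : y ℚ.≤ 0ℚ → 0ℚ ℚ.≤ y ℚ.* y ℚ.* y ℚ.+ η
  negative y≤0 = subst (0ℚ ℚ.≤_)
    -- The difference of the cube and `y` is the product of `-y`, `1 - y` and `1 + y`; the last
    -- factor is split as `(1 - η) + (y + η)`, so that all signs are visible.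
    (solve 2 (λ y η → (y :+ η) :+ (:- y) :* ((con 1ℚ :+ (:- y)) :* ((con 1ℚ :- η) :+ (y :+ η)))
                     := y :* y :* y :+ η) refl y η)
    (0≤+ 0≤y+η (0≤* 0≤-y (0≤* (0≤+ (ℚ.nonNegative⁻¹ 1ℚ) 0≤-y) (0≤+ (p≤q⇒0≤q-p η≤1) 0≤y+η))))
    where
    0≤-y : 0ℚ ℚ.≤ ℚ.- y
    0≤-y = ℚ.neg-antimono-≤ y≤0

-- The choice is η = δ / (s + δ); adding δ keeps the denominator positive even if `s` is 0. Then
-- `1 - η` is `s / (s + δ)`, and `δ - s η` is `δ η`.
small-scale : ∀ {s δ} → 0ℚ ℚ.≤ s → 0ℚ ℚ.< δ →
              ∃[ η ] (0ℚ ℚ.< η × η ℚ.≤ 1ℚ × s ℚ.* η ℚ.≤ δ)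
small-scale {s} {δ} 0≤s 0<δ = η , 0<η , η≤1 , sη≤δ
  where
  instance
    K-pos : ℚ.Positive (s ℚ.+ δ)
    K-pos = ℚ.nonNeg+pos⇒pos s {{ℚ.nonNegative 0≤s}} δ {{ℚ.positive 0<δ}}
    K-nonZero : ℚ.NonZero (s ℚ.+ δ)
    K-nonZero = ℚ.pos⇒nonZero (s ℚ.+ δ)
  w = ℚ.1/ (s ℚ.+ δ)
  η = δ ℚ.* w
  0<w : 0ℚ ℚ.< w
  0<w = ℚ.positive⁻¹ w {{ℚ.1/pos⇒pos (s ℚ.+ δ)}}
  0<η : 0ℚ ℚ.< η
  0<η = ℚ.positive⁻¹ η {{ℚ.pos*pos⇒pos δ {{ℚ.positive 0<δ}} w {{ℚ.positive 0<w}}}}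
  Kw≡1 : (s ℚ.+ δ) ℚ.* w ≡ 1ℚ
  Kw≡1 = ℚ.*-inverseʳ (s ℚ.+ δ)
  η≤1 : η ℚ.≤ 1ℚ
  η≤1 = 0≤q-p⇒p≤q (subst (λ t → 0ℚ ℚ.≤ t ℚ.- η) Kw≡1
    (subst (0ℚ ℚ.≤_) (solve 3 (λ s δ w → s :* w := (s :+ δ) :* w :- δ :* w) refl s δ w)
      (0≤* 0≤s (ℚ.<⇒≤ 0<w))))
  sη≤δ : s ℚ.* η ℚ.≤ δ
  sη≤δ = 0≤q-p⇒p≤q (subst (λ t → 0ℚ ℚ.≤ t ℚ.- s ℚ.* η) (trans (cong (δ ℚ.*_) Kw≡1) (ℚ.*-identityʳ δ))
    (subst (0ℚ ℚ.≤_) (solve 3 (λ s δ w → δ :* (δ :* w) := δ :* ((s :+ δ) :* w) :- s :* (δ :* w)) refl s δ w)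
      (0≤* (ℚ.<⇒≤ 0<δ) (ℚ.<⇒≤ 0<η))))

cubic : ℚ → ℚ → ℚ → ℚ → ℚ → ℚ
cubic c₀ c₁ c₂ c₃ y = c₀ ℚ.+ c₁ ℚ.* y ℚ.+ c₂ ℚ.* (y ℚ.* y) ℚ.+ c₃ ℚ.* (y ℚ.* y ℚ.* y)

cubic-cong : ∀ {c₀ c₁ c₂ c₃ d₀ d₁ d₂ d₃} y → c₀ ≡ d₀ → c₁ ≡ d₁ → c₂ ≡ d₂ → c₃ ≡ d₃ →
             cubic c₀ c₁ c₂ c₃ y ≡ cubic d₀ d₁ d₂ d₃ y
cubic-cong y refl refl refl refl = refl

-- For -η ≤ y < 0 the terms in y and y³ can lose at most η each per unit of coefficient; δ pays for that.
cubic-mono : ∀ {c₀ c₁ c₂ c₃ d₀ d₁ d₂ d₃ y η δ} →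
  c₀ ℚ.≤ d₀ → c₁ ℚ.≤ d₁ → c₂ ℚ.≤ d₂ → c₃ ℚ.≤ d₃ →
  0ℚ ℚ.≤ η → η ℚ.≤ 1ℚ → 0ℚ ℚ.≤ y ℚ.+ η →
  ((d₁ ℚ.- c₁) ℚ.+ (d₃ ℚ.- c₃)) ℚ.* η ℚ.≤ δ →
  cubic c₀ c₁ c₂ c₃ y ℚ.≤ cubic d₀ d₁ d₂ d₃ y ℚ.+ δ
cubic-mono {c₀} {c₁} {c₂} {c₃} {d₀} {d₁} {d₂} {d₃} {y} {η} {δ} h₀ h₁ h₂ h₃ 0≤η η≤1 0≤y+η small =
  0≤q-p⇒p≤q (subst (0ℚ ℚ.≤_) (trans (regroup (d₀ ℚ.- c₀) (d₁ ℚ.- c₁) (d₂ ℚ.- c₂) (d₃ ℚ.- c₃)) difference)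
    (0≤+ (0≤+ (0≤+ (0≤+ (p≤q⇒0≤q-p h₀) (0≤* (p≤q⇒0≤q-p h₁) 0≤y+η)) (0≤* (p≤q⇒0≤q-p h₂) (0≤p*p y)))
      (0≤* (p≤q⇒0≤q-p h₃) (0≤y³+η {y} 0≤η η≤1 0≤y+η))) (p≤q⇒0≤q-p small)))
  where
  regroup : ∀ e₀ e₁ e₂ e₃ →
    e₀ ℚ.+ e₁ ℚ.* (y ℚ.+ η) ℚ.+ e₂ ℚ.* (y ℚ.* y) ℚ.+ e₃ ℚ.* (y ℚ.* y ℚ.* y ℚ.+ η)
      ℚ.+ (δ ℚ.- (e₁ ℚ.+ e₃) ℚ.* η) ≡
    cubic e₀ e₁ e₂ e₃ y ℚ.+ δ
  regroup e₀ e₁ e₂ e₃ = solve 7 (λ e₀ e₁ e₂ e₃ y η δ →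
    e₀ :+ e₁ :* (y :+ η) :+ e₂ :* (y :* y) :+ e₃ :* (y :* y :* y :+ η) :+ (δ :- (e₁ :+ e₃) :* η) :=
    e₀ :+ e₁ :* y :+ e₂ :* (y :* y) :+ e₃ :* (y :* y :* y) :+ δ) refl e₀ e₁ e₂ e₃ y η δ
  difference : cubic (d₀ ℚ.- c₀) (d₁ ℚ.- c₁) (d₂ ℚ.- c₂) (d₃ ℚ.- c₃) y ℚ.+ δ ≡
               cubic d₀ d₁ d₂ d₃ y ℚ.+ δ ℚ.- cubic c₀ c₁ c₂ c₃ y
  difference = linear d₀ c₀ d₁ c₁ d₂ c₂ d₃ c₃ y (y ℚ.* y) (y ℚ.* y ℚ.* y) δ
    where
    -- The powers of `y` enter as independent variables, which leaves the solver an identity linear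
    -- in each of them.
    linear : ∀ d₀ c₀ d₁ c₁ d₂ c₂ d₃ c₃ y y² y³ δ →
      (d₀ ℚ.- c₀) ℚ.+ (d₁ ℚ.- c₁) ℚ.* y ℚ.+ (d₂ ℚ.- c₂) ℚ.* y² ℚ.+ (d₃ ℚ.- c₃) ℚ.* y³ ℚ.+ δ ≡
      d₀ ℚ.+ d₁ ℚ.* y ℚ.+ d₂ ℚ.* y² ℚ.+ d₃ ℚ.* y³ ℚ.+ δ ℚ.- (c₀ ℚ.+ c₁ ℚ.* y ℚ.+ c₂ ℚ.* y² ℚ.+ c₃ ℚ.* y³)
    linear = solve 12 (λ d₀ c₀ d₁ c₁ d₂ c₂ d₃ c₃ y y² y³ δ →
      (d₀ :- c₀) :+ (d₁ :- c₁) :* y :+ (d₂ :- c₂) :* y² :+ (d₃ :- c₃) :* y³ :+ δ :=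
      d₀ :+ d₁ :* y :+ d₂ :* y² :+ d₃ :* y³ :+ δ :- (c₀ :+ c₁ :* y :+ c₂ :* y² :+ c₃ :* y³)) refl

-- Optimality

module _ {v b : ℕ} (𝓕 : TS v b) where

  private
    m : ℕ → ℤ
    m j = + meet 𝓕 j

  -- The left sides copy the bracketing in `taylor`, with multiples written as repeated sums, so
  -- that `add` can carry `_/ 1` through them.
  coefficient₀≡ : m 0 ℤ.+ (m 1 ℤ.+ (m 2 ℤ.+ m 3)) ≡ coefficient 𝓕 0
  coefficient₀≡ = expand (m 0) (m 1) (m 2) (m 3)
    where
    expand : ∀ a b c d → a ℤ.+ (b ℤ.+ (c ℤ.+ d)) ≡
                         + 1 ℤ.* a ℤ.+ (+ 1 ℤ.* b ℤ.+ (+ 1 ℤ.* c ℤ.+ (+ 1 ℤ.* d ℤ.+ 0ℤ)))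
    expand = solve-∀

  coefficient₁≡ : m 1 ℤ.+ ((m 2 ℤ.+ m 2) ℤ.+ (m 3 ℤ.+ (m 3 ℤ.+ m 3))) ≡ coefficient 𝓕 1
  coefficient₁≡ = expand (m 0) (m 1) (m 2) (m 3)
    where
    expand : ∀ a b c d → b ℤ.+ ((c ℤ.+ c) ℤ.+ (d ℤ.+ (d ℤ.+ d))) ≡
                         + 0 ℤ.* a ℤ.+ (+ 1 ℤ.* b ℤ.+ (+ 2 ℤ.* c ℤ.+ (+ 3 ℤ.* d ℤ.+ 0ℤ)))
    expand = solve-∀

  coefficient₂≡ : m 2 ℤ.+ (m 3 ℤ.+ (m 3 ℤ.+ m 3)) ≡ coefficient 𝓕 2
  coefficient₂≡ = expand (m 0) (m 1) (m 2) (m 3)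
    where
    expand : ∀ a b c d → c ℤ.+ (d ℤ.+ (d ℤ.+ d)) ≡
                         + 0 ℤ.* a ℤ.+ (+ 0 ℤ.* b ℤ.+ (+ 1 ℤ.* c ℤ.+ (+ 3 ℤ.* d ℤ.+ 0ℤ)))
    expand = solve-∀

  coefficient₃≡ : m 3 ≡ coefficient 𝓕 3
  coefficient₃≡ = expand (m 0) (m 1) (m 2) (m 3)
    where
    expand : ∀ a b c d → d ≡
                         + 0 ℤ.* a ℤ.+ (+ 0 ℤ.* b ℤ.+ (+ 0 ℤ.* c ℤ.+ (+ 1 ℤ.* d ℤ.+ 0ℤ)))
    expand = solve-∀

  -- Each term of the Cauchy sequence is a rational value of the polynomial, so it can be expanded
  -- at 1 index by index.
  seq-P : ∀ x n → seq (P 𝓕 x) n ≡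
    cubic (coefficient 𝓕 0 / 1) (coefficient 𝓕 1 / 1) (coefficient 𝓕 2 / 1) (coefficient 𝓕 3 / 1)
          (seq x n ℚ.- 1ℚ)
  seq-P x n = trans (taylor (m 0 / 1) (m 1 / 1) (m 2 / 1) (m 3 / 1) (seq x n)) (cubic-cong (seq x n ℚ.- 1ℚ)
    (trans (add (m 0) (m 1 ℤ.+ (m 2 ℤ.+ m 3)) refl (add (m 1) (m 2 ℤ.+ m 3) refl (add (m 2) (m 3) refl refl)))
           (cong (_/ 1) coefficient₀≡))
    (trans (add (m 1) (m 2 ℤ.+ m 2 ℤ.+ (m 3 ℤ.+ (m 3 ℤ.+ m 3))) refl
             (add (m 2 ℤ.+ m 2) (m 3 ℤ.+ (m 3 ℤ.+ m 3)) (add (m 2) (m 2) refl refl) 3m₃))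
           (cong (_/ 1) coefficient₁≡))
    (trans (add (m 2) (m 3 ℤ.+ (m 3 ℤ.+ m 3)) refl 3m₃) (cong (_/ 1) coefficient₂≡))
    (cong (_/ 1) coefficient₃≡))
    where
    taylor : ∀ a b c d q →
      a ℚ.* 1ℚ ℚ.+ b ℚ.* (q ℚ.* 1ℚ) ℚ.+ c ℚ.* (q ℚ.* (q ℚ.* 1ℚ)) ℚ.+ d ℚ.* (q ℚ.* (q ℚ.* (q ℚ.* 1ℚ))) ≡
      cubic (a ℚ.+ (b ℚ.+ (c ℚ.+ d))) (b ℚ.+ ((c ℚ.+ c) ℚ.+ (d ℚ.+ (d ℚ.+ d))))
            (c ℚ.+ (d ℚ.+ (d ℚ.+ d))) d (q ℚ.- 1ℚ)
    taylor = solve 5 (λ a b c d q →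
      a :* con 1ℚ :+ b :* (q :* con 1ℚ) :+ c :* (q :* (q :* con 1ℚ)) :+ d :* (q :* (q :* (q :* con 1ℚ))) :=
      (a :+ (b :+ (c :+ d))) :+ (b :+ ((c :+ c) :+ (d :+ (d :+ d)))) :* (q :- con 1ℚ)
        :+ (c :+ (d :+ (d :+ d))) :* ((q :- con 1ℚ) :* (q :- con 1ℚ))
        :+ d :* ((q :- con 1ℚ) :* (q :- con 1ℚ) :* (q :- con 1ℚ))) refl
    add : ∀ i j {p q} → p ≡ i / 1 → q ≡ j / 1 → p ℚ.+ q ≡ (i ℤ.+ j) / 1
    add i j p≡ q≡ = trans (cong₂ ℚ._+_ p≡ q≡) (sym (/1-+ i j))
    3m₃ : m 3 / 1 ℚ.+ (m 3 / 1 ℚ.+ m 3 / 1) ≡ (m 3 ℤ.+ (m 3 ℤ.+ m 3)) / 1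
    3m₃ = add (m 3) (m 3 ℤ.+ m 3) refl (add (m 3) (m 3) refl refl)

module _ {v b : ℕ} (𝓕 𝓕′ : TS v b) where

  -- The hypothesis `1ᴿ ≤ᴿ x` only says that the terms of `x` are eventually at least `1 - η`. So η
  -- is first chosen from δ and the coefficient gaps, and the index for η then serves for δ.
  coefficients-mono⇒P-mono :
    coefficient 𝓕 0 ℤ.≤ coefficient 𝓕′ 0 → coefficient 𝓕 1 ℤ.≤ coefficient 𝓕′ 1 →
    coefficient 𝓕 2 ℤ.≤ coefficient 𝓕′ 2 → coefficient 𝓕 3 ℤ.≤ coefficient 𝓕′ 3 →
    ∀ x → 1ᴿ ≤ᴿ x → P 𝓕 x ≤ᴿ P 𝓕′ x
  coefficients-mono⇒P-mono h₀ h₁ h₂ h₃ x 1≤x δ 0<δ = proj₁ near-1 , λ n N≤n →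
    subst₂ (λ p q → p ℚ.≤ q ℚ.+ δ) (sym (seq-P 𝓕 x n)) (sym (seq-P 𝓕′ x n))
      (cubic-mono (/1-mono h₀) (/1-mono h₁) (/1-mono h₂) (/1-mono h₃) (ℚ.<⇒≤ 0<η) η≤1
        (subst (0ℚ ℚ.≤_) (shift (seq x n) η) (p≤q⇒0≤q-p (proj₂ near-1 n N≤n)))
        small)
    where
    scale = small-scale (0≤+ (p≤q⇒0≤q-p (/1-mono h₁)) (p≤q⇒0≤q-p (/1-mono h₃))) 0<δ
    η = proj₁ scale
    0<η = proj₁ (proj₂ scale)
    η≤1 = proj₁ (proj₂ (proj₂ scale))
    small = proj₂ (proj₂ (proj₂ scale))
    near-1 = 1≤x η 0<η
    shift : ∀ q η → q ℚ.+ η ℚ.- 1ℚ ≡ q ℚ.- 1ℚ ℚ.+ η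
    shift = solve 2 (λ q η → q :+ η :- con 1ℚ := q :- con 1ℚ :+ η) refl

theorem2p3 : ∀ (v b : ℕ) → C1 v b ⊎ C2 v b →
    (𝓕 : TS v b) → NWBTS 𝓕 → OptimalDataPlacement 𝓕
theorem2p3 v b conditions 𝓕 nwbts 𝓕′ =
  coefficients-mono⇒P-mono 𝓕 𝓕′
    (balanced⇒coefficient-mono 𝓕 𝓕′ 0 (zero-balanced 𝓕))
    (proj₁ c₁,c₂) (proj₂ c₁,c₂)
    (balanced⇒coefficient-mono 𝓕 𝓕′ 3 threeBalanced)
  where
  open NWBTS nwbts using (nearlyTwoBalanced; threeBalanced)
  c₁,c₂ = nearlyTwoBalanced⇒coefficients-mono 𝓕 𝓕′ nearlyTwoBalanced conditions
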